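{- Let $k$ be a positive integer and let $G$ be a graph with $n$ vertices belonging to the class $k_{\mathrm{DIR}}\text{ -CONV}$. Then $G$ has at most $n^k$ (inclusion-wise) maximal cliques.
   Context: All graphs are finite and nonempty. A polygon is a closed convex polygon in $\mathbb{R}^2$. For a finite collection $R$ of sets, its intersection graph has one vertex for each member of $R$, and two distinct vertices are adjacent iff the corresponding sets have nonempty intersection. For a set $L=\{\ell_1,\dots,\ell_k\}$ of $k$ distinct lines through the origin in $\mathbb{R}^2$, $\mathcal{P}(L)$ is the family of all polygons each of whose sides is parallel to some line of $L$. The class $k_{\mathrm{DIR}(L)}\text{ -CONV}$ consists of all intersection graphs of finite collections of polygons from $\mathcal{P}(L)$, and $k_{\mathrm{DIR}}\text{ -CONV}$ is the union of the classes $k_{\mathrm{DIR}(L)}\text{ -CONV}$ over all sets $L$ of $k$ distinct lines through the origin. -}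

module Defs where

open import Algebra.Bundles using (CommutativeMonoid)
import Algebra.Properties.CommutativeSemigroup as CommutativeSemigroup
import Algebra.Properties.Ring as Ring
open import Data.Fin using (Fin)
open import Data.Fin.Subset using (Subset; _∈_; _⊆_)
open import Data.Nat as ℕ using (ℕ)
import Data.Nat.Properties as ℕ
open import Data.Product using (_×_; _,_; ∃-syntax)
open import Data.Rational as ℚ using (ℚ; 0ℚ; 1ℚ; ½; ∣_∣; 1/_)
import Data.Rational.Properties as ℚ
open import Data.Vec.Functional using (foldr; _∷_; [])
open import Function.Bundles using (_⇔_)
open import Relation.Binary.PropositionalEquality
  using (_≡_; _≢_; sym; trans; cong; cong₂; subst; module ≡-Reasoning)
open import Relation.Nullary using (¬_)

-- The real numbers are the Cauchy sequences of rationals, compared up to _≈_.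

IsCauchy : (ℕ → ℚ) → Set
IsCauchy s = ∀ ε → 0ℚ ℚ.< ε →
  ∃[ N ] (∀ m n → N ℕ.≤ m → N ℕ.≤ n → ∣ s m ℚ.- s n ∣ ℚ.< ε)

record ℝ : Set where
  constructor mkℝ
  field
    seq    : ℕ → ℚ
    cauchy : IsCauchy seq
open ℝ public

infix  4 _≈_ _<_ _≤_
infixl 6 _+_ _-_
infixl 7 _*_
infix  8 -_

record _≈_ (x y : ℝ) : Set where
  constructor mk≈
  field
    close : ∀ ε → 0ℚ ℚ.< ε →
      ∃[ N ] (∀ n → N ℕ.≤ n → ∣ seq x n ℚ.- seq y n ∣ ℚ.< ε)

record _<_ (x y : ℝ) : Set where
  constructor mk<
  field
    gap      : ℚ
    gap>0    : 0ℚ ℚ.< gap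
    eventual : ∃[ N ] (∀ n → N ℕ.≤ n → seq x n ℚ.+ gap ℚ.≤ seq y n)

_≤_ : ℝ → ℝ → Set
x ≤ y = ¬ (y < x)

abstract
  private
    minus-sum : ∀ a b c d → a ℚ.+ b ℚ.- (c ℚ.+ d) ≡ (a ℚ.- c) ℚ.+ (b ℚ.- d)
    minus-sum a b c d =
      trans (cong (a ℚ.+ b ℚ.+_) (ℚ.neg-distrib-+ c d))
            (interchange a b (ℚ.- c) (ℚ.- d))
      where
      open CommutativeSemigroup
        (CommutativeMonoid.commutativeSemigroup ℚ.+-0-commutativeMonoid)
        using (interchange)

    minus-plus : ∀ a b → a ≡ (a ℚ.- b) ℚ.+ b
    minus-plus a b = sym (begin
      a ℚ.- b ℚ.+ b          ≡⟨ ℚ.+-assoc a (ℚ.- b) b ⟩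
      a ℚ.+ (ℚ.- b ℚ.+ b)    ≡⟨ cong (a ℚ.+_) (ℚ.+-inverseˡ b) ⟩
      a ℚ.+ 0ℚ               ≡⟨ ℚ.+-identityʳ a ⟩
      a                      ∎)
      where open ≡-Reasoning

    minus-prod : ∀ a b c d →
      a ℚ.* b ℚ.- c ℚ.* d ≡ a ℚ.* (b ℚ.- d) ℚ.+ d ℚ.* (a ℚ.- c)
    minus-prod a b c d = begin
      a ℚ.* b ℚ.- c ℚ.* d
        ≡⟨ cong (ℚ._- c ℚ.* d) (minus-plus (a ℚ.* b) (a ℚ.* d)) ⟩
      (a ℚ.* b ℚ.- a ℚ.* d) ℚ.+ a ℚ.* d ℚ.- c ℚ.* d
        ≡⟨ ℚ.+-assoc (a ℚ.* b ℚ.- a ℚ.* d) (a ℚ.* d) (ℚ.- (c ℚ.* d)) ⟩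
      (a ℚ.* b ℚ.- a ℚ.* d) ℚ.+ (a ℚ.* d ℚ.- c ℚ.* d)
        ≡⟨ cong₂ ℚ._+_ (x[y-z]≈xy-xz a b d) ([y-z]x≈yx-zx d a c) ⟨
      a ℚ.* (b ℚ.- d) ℚ.+ (a ℚ.- c) ℚ.* d
        ≡⟨ cong (a ℚ.* (b ℚ.- d) ℚ.+_) (ℚ.*-comm (a ℚ.- c) d) ⟩
      a ℚ.* (b ℚ.- d) ℚ.+ d ℚ.* (a ℚ.- c) ∎
      where
      open ≡-Reasoning
      open Ring ℚ.+-*-ring using (x[y-z]≈xy-xz; [y-z]x≈yx-zx)

    half+half : ∀ ε → ½ ℚ.* ε ℚ.+ ½ ℚ.* ε ≡ ε
    half+half ε = trans (sym (ℚ.*-distribʳ-+ ε ½ ½)) (ℚ.*-identityˡ ε)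

    half-pos : ∀ ε → 0ℚ ℚ.< ε → 0ℚ ℚ.< ½ ℚ.* ε
    half-pos ε 0<ε = subst (ℚ._< ½ ℚ.* ε) (ℚ.*-zeroʳ ½) (ℚ.*-monoʳ-<-pos ½ 0<ε)

  cauchy-const : ∀ q → IsCauchy (λ _ → q)
  cauchy-const q ε 0<ε =
    0 , λ _ _ _ _ → subst (ℚ._< ε) (sym (cong ∣_∣ (ℚ.+-inverseʳ q))) 0<ε

  cauchy-+ : ∀ x y → IsCauchy (λ n → seq x n ℚ.+ seq y n)
  cauchy-+ (mkℝ s cs) (mkℝ t ct) ε 0<ε
    with cs (½ ℚ.* ε) (half-pos ε 0<ε) | ct (½ ℚ.* ε) (half-pos ε 0<ε)
  ... | M , hs | N , ht = M ℕ.⊔ N , λ m n p q → begin-strict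
      ∣ s m ℚ.+ t m ℚ.- (s n ℚ.+ t n) ∣
        ≡⟨ cong ∣_∣ (minus-sum (s m) (t m) (s n) (t n)) ⟩
      ∣ (s m ℚ.- s n) ℚ.+ (t m ℚ.- t n) ∣
        ≤⟨ ℚ.∣p+q∣≤∣p∣+∣q∣ (s m ℚ.- s n) (t m ℚ.- t n) ⟩
      ∣ s m ℚ.- s n ∣ ℚ.+ ∣ t m ℚ.- t n ∣
        <⟨ ℚ.+-mono-< (hs m n (ℕ.m⊔n≤o⇒m≤o M N p) (ℕ.m⊔n≤o⇒m≤o M N q))
                      (ht m n (ℕ.m⊔n≤o⇒n≤o M N p) (ℕ.m⊔n≤o⇒n≤o M N q)) ⟩
      ½ ℚ.* ε ℚ.+ ½ ℚ.* ε
        ≡⟨ half+half ε ⟩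
      ε ∎
    where
    open ℚ.≤-Reasoning

  cauchy-neg : ∀ x → IsCauchy (λ n → ℚ.- seq x n)
  cauchy-neg (mkℝ s cs) ε 0<ε with cs ε 0<ε
  ... | N , hs = N , λ m n p q → subst (ℚ._< ε)
          (trans (sym (ℚ.∣-p∣≡∣p∣ (s m ℚ.- s n)))
                 (cong ∣_∣ (ℚ.neg-distrib-+ (s m) (ℚ.- s n))))
          (hs m n p q)

  cauchy-bounded : ∀ {s} → IsCauchy s →
    ∃[ B ] (0ℚ ℚ.< B × ∃[ N ] (∀ n → N ℕ.≤ n → ∣ s n ∣ ℚ.≤ B))
  cauchy-bounded {s} cs with cs 1ℚ (ℚ.positive⁻¹ 1ℚ)
  ... | N , hs = 1ℚ ℚ.+ ∣ s N ∣
      , ℚ.+-mono-<-≤ (ℚ.positive⁻¹ 1ℚ) (ℚ.0≤∣p∣ (s N))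
      , N , λ n p → begin
        ∣ s n ∣                         ≡⟨ cong ∣_∣ (minus-plus (s n) (s N)) ⟩
        ∣ (s n ℚ.- s N) ℚ.+ s N ∣       ≤⟨ ℚ.∣p+q∣≤∣p∣+∣q∣ (s n ℚ.- s N) (s N) ⟩
        ∣ s n ℚ.- s N ∣ ℚ.+ ∣ s N ∣
          ≤⟨ ℚ.+-monoˡ-≤ ∣ s N ∣ (ℚ.<⇒≤ (hs n N p ℕ.≤-refl)) ⟩
        1ℚ ℚ.+ ∣ s N ∣                  ∎
    where
    open ℚ.≤-Reasoning

  private
    shrink : ∀ B → 0ℚ ℚ.< B → ∀ ε → 0ℚ ℚ.< ε →
      ∃[ δ ] (0ℚ ℚ.< δ × B ℚ.* δ ≡ ½ ℚ.* ε)
    shrink B 0<B ε 0<ε = δ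
      , subst (ℚ._< δ) (ℚ.*-zeroʳ (1/ B))
          (ℚ.*-monoʳ-<-pos (1/ B) (half-pos ε 0<ε))
      , trans (sym (ℚ.*-assoc B (1/ B) (½ ℚ.* ε)))
          (trans (cong (ℚ._* (½ ℚ.* ε)) (ℚ.*-inverseʳ B)) (ℚ.*-identityˡ (½ ℚ.* ε)))
      where
      instance
        B-pos : ℚ.Positive B
        B-pos = ℚ.positive 0<B
        B≢0 : ℚ.NonZero B
        B≢0 = ℚ.pos⇒nonZero B
        1/B-pos : ℚ.Positive (1/ B)
        1/B-pos = ℚ.1/pos⇒pos B
      δ : ℚ
      δ = (1/ B) ℚ.* (½ ℚ.* ε)

    product-bound : ∀ {a b B δ c} → 0ℚ ℚ.< B → ∣ a ∣ ℚ.≤ B → ∣ b ∣ ℚ.< δ →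
      B ℚ.* δ ≡ c → ∣ a ℚ.* b ∣ ℚ.< c
    product-bound {a} {b} {B} {δ} {c} 0<B a≤B b<δ eq = begin-strict
        ∣ a ℚ.* b ∣        ≡⟨ ℚ.∣p*q∣≡∣p∣*∣q∣ a b ⟩
        ∣ a ∣ ℚ.* ∣ b ∣    ≤⟨ ℚ.*-monoʳ-≤-nonNeg ∣ b ∣ a≤B ⟩
        B ℚ.* ∣ b ∣        <⟨ ℚ.*-monoʳ-<-pos B b<δ ⟩
        B ℚ.* δ            ≡⟨ eq ⟩
        c                  ∎
      where
      open ℚ.≤-Reasoning
      instance
        B-pos : ℚ.Positive B
        B-pos = ℚ.positive 0<B
        ∣b∣-nonNeg : ℚ.NonNegative ∣ b ∣
        ∣b∣-nonNeg = ℚ.∣-∣-nonNeg b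

  cauchy-* : ∀ x y → IsCauchy (λ n → seq x n ℚ.* seq y n)
  cauchy-* (mkℝ s cs) (mkℝ t ct) ε 0<ε
    with cauchy-bounded {s} cs | cauchy-bounded {t} ct
  ... | A , 0<A , K , s≤A | B , 0<B , L , t≤B
    with shrink A 0<A ε 0<ε | shrink B 0<B ε 0<ε
  ... | α , 0<α , Aα | β , 0<β , Bβ
    with cs β 0<β | ct α 0<α
  ... | M , hs | N , ht = (K ℕ.⊔ L) ℕ.⊔ (M ℕ.⊔ N) , λ m n p q →
      let p₁ = ℕ.m⊔n≤o⇒m≤o (K ℕ.⊔ L) (M ℕ.⊔ N) p
          p₂ = ℕ.m⊔n≤o⇒n≤o (K ℕ.⊔ L) (M ℕ.⊔ N) p
          q₁ = ℕ.m⊔n≤o⇒m≤o (K ℕ.⊔ L) (M ℕ.⊔ N) q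
          q₂ = ℕ.m⊔n≤o⇒n≤o (K ℕ.⊔ L) (M ℕ.⊔ N) q
      in begin-strict
      ∣ s m ℚ.* t m ℚ.- s n ℚ.* t n ∣
        ≡⟨ cong ∣_∣ (minus-prod (s m) (t m) (s n) (t n)) ⟩
      ∣ s m ℚ.* (t m ℚ.- t n) ℚ.+ t n ℚ.* (s m ℚ.- s n) ∣
        ≤⟨ ℚ.∣p+q∣≤∣p∣+∣q∣ (s m ℚ.* (t m ℚ.- t n)) (t n ℚ.* (s m ℚ.- s n)) ⟩
      ∣ s m ℚ.* (t m ℚ.- t n) ∣ ℚ.+ ∣ t n ℚ.* (s m ℚ.- s n) ∣
        <⟨ ℚ.+-mono-<
             (product-bound {a = s m} {b = t m ℚ.- t n} 0<A
               (s≤A m (ℕ.m⊔n≤o⇒m≤o K L p₁))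
               (ht m n (ℕ.m⊔n≤o⇒n≤o M N p₂) (ℕ.m⊔n≤o⇒n≤o M N q₂)) Aα)
             (product-bound {a = t n} {b = s m ℚ.- s n} 0<B
               (t≤B n (ℕ.m⊔n≤o⇒n≤o K L q₁))
               (hs m n (ℕ.m⊔n≤o⇒m≤o M N p₂) (ℕ.m⊔n≤o⇒m≤o M N q₂)) Bβ) ⟩
      ½ ℚ.* ε ℚ.+ ½ ℚ.* ε
        ≡⟨ half+half ε ⟩
      ε ∎
    where
    open ℚ.≤-Reasoning

fromℚ : ℚ → ℝ
fromℚ q = mkℝ (λ _ → q) (cauchy-const q)

0ℝ 1ℝ : ℝ
0ℝ = fromℚ 0ℚ
1ℝ = fromℚ 1ℚ

_+_ _*_ : ℝ → ℝ → ℝ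
x + y = mkℝ (λ n → seq x n ℚ.+ seq y n) (cauchy-+ x y)
x * y = mkℝ (λ n → seq x n ℚ.* seq y n) (cauchy-* x y)

-_ : ℝ → ℝ
- x = mkℝ (λ n → ℚ.- seq x n) (cauchy-neg x)

_-_ : ℝ → ℝ → ℝ
x - y = x + - y

sum : ∀ {m} → (Fin m → ℝ) → ℝ
sum = foldr _+_ 0ℝ

infix 4 _≈ₚ_ _∈ₚ_
infixl 6 _-ₚ_

record Point : Set where
  constructor _,ₚ_
  field
    x-coord y-coord : ℝ
open Point public

_≈ₚ_ : Point → Point → Set
p ≈ₚ q = x-coord p ≈ x-coord q × y-coord p ≈ y-coord q

_-ₚ_ : Point → Point → Point
p -ₚ q = (x-coord p - x-coord q) ,ₚ (y-coord p - y-coord q)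

origin : Point
origin = 0ℝ ,ₚ 0ℝ

cross : Point → Point → ℝ
cross u v = x-coord u * y-coord v - y-coord u * x-coord v

-- Used for nonzero u and v only, where it says that they span the same line.
Parallel : Point → Point → Set
Parallel u v = cross u v ≈ 0ℝ

Region : Set₁
Region = Point → Set

_∈ₚ_ : Point → Region → Set
p ∈ₚ K = K p

hull : ∀ {m} → (Fin m → Point) → Region
hull v p = ∃[ w ]
  ( (∀ i → 0ℝ ≤ w i)
  × sum w ≈ 1ℝ
  × x-coord p ≈ sum (λ i → w i * x-coord (v i))
  × y-coord p ≈ sum (λ i → w i * y-coord (v i)))

segment : Point → Point → Region
segment a b = hull (a ∷ b ∷ [])

-- The positive sign of `orient a b c` means that c lies to the left of the
-- line through a and b, directed from a to b.
orient : Point → Point → Point → ℝ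
orient a b c = cross (b -ₚ a) (c -ₚ a)

-- The segment from a to b is a side of the convex region K: it is
-- nondegenerate, K lies on one side of its line, and it is all that K has in
-- common with that line.
IsSide : Region → Point → Point → Set
IsSide K a b =
    ¬ (a ≈ₚ b)
  × (∀ c → c ∈ₚ K → 0ℝ ≤ orient a b c)
  × (∀ c → (c ∈ₚ K × orient a b c ≈ 0ℝ) ⇔ c ∈ₚ segment a b)

-- A convex polygon, as the hull of finitely many, but at least one, points.
-- The points need not be in convex position, and the degenerate polygons are
-- included: a segment has itself as its only side, a point has no sides.
record Polygon : Set where
  field
    size-1     : ℕ
    generators : Fin (ℕ.suc size-1) → Point

  region : Region
  region = hull generators
open Polygon public using (region)

-- Each line through the origin is given by a nonzero direction vector.
record Lines (k : ℕ) : Set where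
  field
    direction : Fin k → Point
    nonzero   : ∀ i → ¬ (direction i ≈ₚ origin)
    distinct  : ∀ i j → i ≢ j → ¬ Parallel (direction i) (direction j)
open Lines public

_∈𝒫_ : ∀ {k} → Polygon → Lines k → Set
P ∈𝒫 L = ∀ a b → IsSide (region P) a b → ∃[ i ] Parallel (b -ₚ a) (direction L i)

Intersecting : Polygon → Polygon → Set
Intersecting P Q = ∃[ p ] (p ∈ₚ region P × p ∈ₚ region Q)

record Graph (n : ℕ) : Set₁ where
  field
    Adjacent    : Fin n → Fin n → Set
    symmetric   : ∀ {u v} → Adjacent u v → Adjacent v u
    irreflexive : ∀ {v} → ¬ Adjacent v v
open Graph public

IsIntersectionGraph : ∀ {n} → Graph n → (Fin n → Polygon) → Set
IsIntersectionGraph G P =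
  ∀ u v → u ≢ v → Adjacent G u v ⇔ Intersecting (P u) (P v)

-- The collection of polygons is a family indexed by the vertices, possibly with
-- repetitions.
DIR[_]-CONV : ∀ {k n} → Lines k → Graph n → Set
DIR[_]-CONV {n = n} L G =
  ∃[ P ] ((∀ (v : Fin n) → P v ∈𝒫 L) × IsIntersectionGraph G P)

_-DIR-CONV : ∀ {n} → ℕ → Graph n → Set
(k -DIR-CONV) G = ∃[ L ] DIR[_]-CONV {k} L G

IsClique : ∀ {n} → Graph n → Subset n → Set
IsClique G S = ∀ u v → u ∈ S → v ∈ S → u ≢ v → Adjacent G u v

IsMaximalClique : ∀ {n} → Graph n → Subset n → Set
IsMaximalClique G S = IsClique G S × (∀ T → IsClique G T → S ⊆ T → T ⊆ S)

{-# OPTIONS --safe #-}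
module Submission where

-- Order the plane, for each direction of L, lexicographically: by the height above the direction,
-- and by the position along it among points of equal height.  If two polygons of 𝒫(L) are
-- disjoint, then one lies entirely before the other in one of these orders.  Indeed, their
-- Minkowski difference misses the origin, and a facet of it that is visible from the origin is
-- parallel to a side of one of the two polygons; the second coordinate of the order handles the
-- disjoint polygons (points and segments) that lie on a common line of that direction.
--
-- In a maximal clique C choose, for each direction, a member v whose first point comes latest.
-- These k choices determine C: suppose that they serve for C′ as well, and that u ∈ C and w ∈ C′
-- are disjoint, u coming before w, say.  Then the first point of w is no later than that of v,
-- hence no later than a point common to u and v, which contradicts the separation.  So C ∪ C′ is
-- a clique, and C = C′ by maximality.
--
-- Comparisons of reals are not decidable, so the argument takes place under a double negation,
-- which the decidable conclusion absorbs.

open import Defs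
open import Algebra.Bundles using (CommutativeRing)
import Algebra.Properties.CommutativeMonoid.Sum
import Algebra.Properties.Semiring.Sum
import Algebra.Solver.Ring
open import Algebra.Solver.Ring.AlmostCommutativeRing using (fromCommutativeRing; _-Raw-AlmostCommutative⟶_)
open import Data.Empty using (⊥; ⊥-elim)
open import Data.Fin as Fin using (Fin; zero; suc; funToFin; finToFun)
import Data.Fin.Properties as Fin
open import Data.Fin.Subset using (Subset; _∈_; _∪_; ⁅_⁆; Nonempty)
open import Data.Fin.Subset.Properties using (⊆-antisym; p⊆p∪q; q⊆p∪q; x∈p∪q⁻; x∈⁅x⁆; x∈⁅y⁆⇒x≡y; nonempty?)
open import Data.List using (List; []; _∷_; allFin; cartesianProduct; length; lookup)
open import Data.List.Membership.Propositional using () renaming (_∈_ to _∈ₗ_)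
open import Data.List.Membership.Propositional.Properties using (∈-allFin; ∈-cartesianProduct⁺; ∈-lookup)
open import Data.List.Relation.Unary.All as All using (All)
open import Data.List.Relation.Unary.AllPairs using (_∷_)
open import Data.List.Relation.Unary.Any using (here; there)
open import Data.List.Relation.Unary.Unique.Propositional using (Unique)
open import Data.Maybe using (Maybe; just; nothing)
open import Data.Nat as ℕ using (ℕ; NonZero; _^_) renaming (_≤_ to _≤ℕ_)
import Data.Nat.Properties as ℕ
open import Data.Product using (_×_; _,_; ∃-syntax; proj₁; proj₂)
open import Data.Rational as ℚ using (ℚ; 0ℚ; 1ℚ; ½; ∣_∣; 1/_)
import Data.Rational.Properties as ℚ
open import Data.Rational.Solver using (module +-*-Solver)
open import Data.Sum using (_⊎_; inj₁; inj₂; [_,_]′)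
open import Data.Unit using (⊤; tt)
import Data.Vec.Functional as Vector
open import Effect.Monad using (RawMonad)
open import Function using (id)
open import Function.Bundles using (Equivalence; mk⇔)
open import Level using (0ℓ)
import Relation.Binary.Reasoning.Setoid as SetoidReasoning
open import Relation.Binary.PropositionalEquality as ≡ using (_≡_; _≢_; refl; cong; cong₂; subst; subst₂)
open import Relation.Nullary using (¬_; Dec; yes; no)
open import Relation.Nullary.Decidable using (¬¬-excluded-middle)
open import Relation.Nullary.Negation using (¬¬-Monad)

infixl 1 _>>=_

-- Since the target is a negation, it may be derived from facts known only up to double negation.
-- Inequalities `_≤_` are negations, hence targets of this kind.
_>>=_ : ∀ {A B : Set} → ¬ ¬ A → (A → ¬ B) → ¬ B
(m >>= f) b = m λ a → f a b

-- Real numbers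

module _ where
  open +-*-Solver using (solve; _:=_; _:+_; _:*_; :-_; _:-_; con)

  -- Linear rearrangements of rational inequalities are reduced to an identity between the two
  -- differences, which the ring solver checks.
  shift-≤ : ∀ {x y p q} → y ℚ.- x ≡ q ℚ.- p → x ℚ.≤ y → p ℚ.≤ q
  shift-≤ {x} {y} {p} {q} eq h = subst₂ ℚ._≤_
    (solve 2 (λ x p → x :+ (p :- x) := p) refl x p)
    (≡.trans (solve 3 (λ x y p → y :+ (p :- x) := (y :- x) :+ p) refl x y p)
      (≡.trans (cong (ℚ._+ p) eq) (solve 2 (λ p q → (q :- p) :+ p := q) refl p q)))
    (ℚ.+-monoˡ-≤ (p ℚ.- x) h)

  shift-< : ∀ {x y p q} → y ℚ.- x ≡ q ℚ.- p → x ℚ.< y → p ℚ.< q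
  shift-< {x} {y} {p} {q} eq h = subst₂ ℚ._<_
    (solve 2 (λ x p → x :+ (p :- x) := p) refl x p)
    (≡.trans (solve 3 (λ x y p → y :+ (p :- x) := (y :- x) :+ p) refl x y p)
      (≡.trans (cong (ℚ._+ p) eq) (solve 2 (λ p q → (q :- p) :+ p := q) refl p q)))
    (ℚ.+-monoˡ-< (p ℚ.- x) h)

  p≤∣p∣ : ∀ p → p ℚ.≤ ∣ p ∣
  p≤∣p∣ p with 0ℚ ℚ.≤? p
  ... | yes 0≤p = ℚ.≤-reflexive (≡.sym (ℚ.0≤p⇒∣p∣≡p 0≤p))
  ... | no 0≰p = ℚ.≤-trans (ℚ.<⇒≤ (ℚ.≰⇒> 0≰p)) (ℚ.0≤∣p∣ p)

  -p≤∣p∣ : ∀ p → ℚ.- p ℚ.≤ ∣ p ∣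
  -p≤∣p∣ p = subst (ℚ.- p ℚ.≤_) (ℚ.∣-p∣≡∣p∣ p) (p≤∣p∣ (ℚ.- p))

  ∣∣-< : ∀ {p ε} → p ℚ.< ε → ℚ.- p ℚ.< ε → ∣ p ∣ ℚ.< ε
  ∣∣-< {p} {ε} h₁ h₂ = [ (λ e → subst (ℚ._< ε) (≡.sym e) h₁)
                       , (λ e → subst (ℚ._< ε) (≡.sym e) h₂) ]′ (ℚ.∣p∣≡p∨∣p∣≡-p p)

  half-pos : ∀ {ε} → 0ℚ ℚ.< ε → 0ℚ ℚ.< ½ ℚ.* ε
  half-pos {ε} 0<ε = subst (ℚ._< ½ ℚ.* ε) (ℚ.*-zeroʳ ½) (ℚ.*-monoʳ-<-pos ½ 0<ε)

  *-pos : ∀ {p q} → 0ℚ ℚ.< p → 0ℚ ℚ.< q → 0ℚ ℚ.< p ℚ.* q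
  *-pos {p} {q} 0<p 0<q = subst (ℚ._< p ℚ.* q) (ℚ.*-zeroʳ p)
    (ℚ.*-monoʳ-<-pos p {{ℚ.positive 0<p}} 0<q)

  *-mono-≤ : ∀ {p q r s} → 0ℚ ℚ.≤ r → 0ℚ ℚ.≤ q → p ℚ.≤ q → r ℚ.≤ s → p ℚ.* r ℚ.≤ q ℚ.* s
  *-mono-≤ {p} {q} {r} {s} 0≤r 0≤q h k = ℚ.≤-trans
    (ℚ.*-monoʳ-≤-nonNeg r {{ℚ.nonNegative 0≤r}} h)
    (ℚ.*-monoˡ-≤-nonNeg q {{ℚ.nonNegative 0≤q}} k)

  reciprocal : ∀ p → 0ℚ ℚ.< p → ∃[ q ] (0ℚ ℚ.< q × p ℚ.* q ≡ 1ℚ)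
  reciprocal p 0<p = 1/ p , ℚ.positive⁻¹ (1/ p) {{ℚ.1/pos⇒pos p}} , ℚ.*-inverseʳ p
    where
    instance
      p-pos : ℚ.Positive p
      p-pos = ℚ.positive 0<p
      p≢0 : ℚ.NonZero p
      p≢0 = ℚ.pos⇒nonZero p

  -- Eventual bounds, null sequences and the ring of reals

  Eventually : (ℕ → Set) → Set
  Eventually P = ∃[ N ] (∀ n → N ℕ.≤ n → P n)

  always : ∀ {P : ℕ → Set} → (∀ n → P n) → Eventually P
  always h = 0 , λ n _ → h n

  eventually-map : ∀ {P Q : ℕ → Set} → (∀ n → P n → Q n) → Eventually P → Eventually Q
  eventually-map f (N , h) = N , λ n p → f n (h n p)

  eventually-zip : ∀ {P Q R : ℕ → Set} → (∀ n → P n → Q n → R n) →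
    Eventually P → Eventually Q → Eventually R
  eventually-zip f (M , g) (N , h) = M ℕ.⊔ N , λ n p →
    f n (g n (ℕ.m⊔n≤o⇒m≤o M N p)) (h n (ℕ.m⊔n≤o⇒n≤o M N p))

  eventually-refute : ∀ {P : ℕ → Set} → (∀ n → ¬ P n) → ¬ Eventually P
  eventually-refute f (N , h) = f N (h N ℕ.≤-refl)

  -- Two reals are equal when the difference of their sequences is null, so the laws of `_≈_` follow
  -- from closure properties of null sequences.
  Null : (ℕ → ℚ) → Set
  Null s = ∀ ε → 0ℚ ℚ.< ε → Eventually λ n → ∣ s n ∣ ℚ.< ε

  null-resp : ∀ {s t} → (∀ n → s n ≡ t n) → Null s → Null t
  null-resp e h ε 0<ε = eventually-map (λ n → subst (λ p → ∣ p ∣ ℚ.< ε) (e n)) (h ε 0<ε)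

  null-+ : ∀ {s t} → Null s → Null t → Null (λ n → s n ℚ.+ t n)
  null-+ {s} {t} hs ht ε 0<ε = eventually-zip
    (λ n h k → ℚ.≤-<-trans (ℚ.∣p+q∣≤∣p∣+∣q∣ (s n) (t n))
      (subst (∣ s n ∣ ℚ.+ ∣ t n ∣ ℚ.<_)
        (solve 1 (λ e → con ½ :* e :+ con ½ :* e := e) refl ε) (ℚ.+-mono-< h k)))
    (hs _ (half-pos 0<ε)) (ht _ (half-pos 0<ε))

  null-neg : ∀ {s} → Null s → Null (λ n → ℚ.- s n)
  null-neg {s} h ε 0<ε = eventually-map
    (λ n → subst (ℚ._< ε) (≡.sym (ℚ.∣-p∣≡∣p∣ (s n)))) (h ε 0<ε)

  -- A Cauchy sequence is eventually bounded by some B, so it suffices to bring s below ε / B.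
  null-* : ∀ {s} (x : ℝ) → Null s → Null (λ n → s n ℚ.* seq x n)
  null-* {s} x h ε 0<ε with cauchy-bounded {seq x} (cauchy x)
  ... | B , 0<B , bounded with reciprocal B 0<B
  ... | C , 0<C , BC = eventually-zip step (h (C ℚ.* ε) (*-pos 0<C 0<ε)) bounded
    where
    step : ∀ n → ∣ s n ∣ ℚ.< C ℚ.* ε → ∣ seq x n ∣ ℚ.≤ B → ∣ s n ℚ.* seq x n ∣ ℚ.< ε
    step n h k = begin-strict
      ∣ s n ℚ.* seq x n ∣       ≡⟨ ℚ.∣p*q∣≡∣p∣*∣q∣ (s n) (seq x n) ⟩
      ∣ s n ∣ ℚ.* ∣ seq x n ∣   ≤⟨ ℚ.*-monoˡ-≤-nonNeg ∣ s n ∣ {{ℚ.∣-∣-nonNeg (s n)}} k ⟩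
      ∣ s n ∣ ℚ.* B             <⟨ ℚ.*-monoˡ-<-pos B {{ℚ.positive 0<B}} h ⟩
      C ℚ.* ε ℚ.* B             ≡⟨ solve 3 (λ B C e → C :* e :* B := B :* C :* e) refl B C ε ⟩
      B ℚ.* C ℚ.* ε             ≡⟨ cong (ℚ._* ε) BC ⟩
      1ℚ ℚ.* ε                  ≡⟨ ℚ.*-identityˡ ε ⟩
      ε                         ∎
      where open ℚ.≤-Reasoning

  pointwise : ∀ {x y} → (∀ n → seq x n ≡ seq y n) → x ≈ y
  pointwise {x} {y} e = mk≈ λ ε 0<ε → always λ n →
    subst (λ p → ∣ p ∣ ℚ.< ε)
      (≡.sym (≡.trans (cong (ℚ._- seq y n) (e n)) (ℚ.+-inverseʳ (seq y n)))) 0<ε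

  ≈-refl : ∀ {x} → x ≈ x
  ≈-refl = pointwise λ _ → refl

  ≈-sym : ∀ {x y} → x ≈ y → y ≈ x
  ≈-sym {x} {y} (mk≈ h) = mk≈ (null-resp
    (λ n → solve 2 (λ a b → :- (a :- b) := b :- a) refl (seq x n) (seq y n)) (null-neg h))

  ≈-trans : ∀ {x y z} → x ≈ y → y ≈ z → x ≈ z
  ≈-trans {x} {y} {z} (mk≈ h) (mk≈ k) = mk≈ (null-resp
    (λ n → solve 3 (λ a b c → (a :- b) :+ (b :- c) := a :- c) refl (seq x n) (seq y n) (seq z n))
    (null-+ h k))

  +-cong : ∀ {x y u v} → x ≈ y → u ≈ v → x + u ≈ y + v
  +-cong {x} {y} {u} {v} (mk≈ h) (mk≈ k) = mk≈ (null-resp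
    (λ n → solve 4 (λ a b c d → (a :- b) :+ (c :- d) := (a :+ c) :- (b :+ d)) refl
      (seq x n) (seq y n) (seq u n) (seq v n))
    (null-+ h k))

  neg-cong : ∀ {x y} → x ≈ y → - x ≈ - y
  neg-cong {x} {y} (mk≈ h) = mk≈ (null-resp
    (λ n → solve 2 (λ a b → :- (a :- b) := :- a :- (:- b)) refl (seq x n) (seq y n)) (null-neg h))

  *-cong : ∀ {x y u v} → x ≈ y → u ≈ v → x * u ≈ y * v
  *-cong {x} {y} {u} {v} (mk≈ h) (mk≈ k) = mk≈ (null-resp
    (λ n → solve 4 (λ a b c d → (a :- b) :* c :+ (c :- d) :* b := a :* c :- b :* d) refl
      (seq x n) (seq y n) (seq u n) (seq v n))
    (null-+ (null-* u h) (null-* y k)))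

  ℝ-commutativeRing : CommutativeRing 0ℓ 0ℓ
  ℝ-commutativeRing = record
    { _≈_ = _≈_ ; _+_ = _+_ ; _*_ = _*_ ; -_ = -_ ; 0# = 0ℝ ; 1# = 1ℝ
    ; isCommutativeRing = record
      { isRing = record
        { +-isAbelianGroup = record
          { isGroup = record
            { isMonoid = record
              { isSemigroup = record
                { isMagma = record
                  { isEquivalence = record { refl = ≈-refl ; sym = ≈-sym ; trans = ≈-trans }
                  ; ∙-cong = +-cong }
                ; assoc = λ x y z → pointwise λ n → ℚ.+-assoc (seq x n) (seq y n) (seq z n) }
              ; identity = (λ x → pointwise λ n → ℚ.+-identityˡ (seq x n))
                         , (λ x → pointwise λ n → ℚ.+-identityʳ (seq x n)) }
            ; inverse = (λ x → pointwise λ n → ℚ.+-inverseˡ (seq x n))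
                      , (λ x → pointwise λ n → ℚ.+-inverseʳ (seq x n))
            ; ⁻¹-cong = neg-cong }
          ; comm = λ x y → pointwise λ n → ℚ.+-comm (seq x n) (seq y n) }
        ; *-cong = *-cong
        ; *-assoc = λ x y z → pointwise λ n → ℚ.*-assoc (seq x n) (seq y n) (seq z n)
        ; *-identity = (λ x → pointwise λ n → ℚ.*-identityˡ (seq x n))
                     , (λ x → pointwise λ n → ℚ.*-identityʳ (seq x n))
        ; distrib = (λ x y z → pointwise λ n → ℚ.*-distribˡ-+ (seq x n) (seq y n) (seq z n))
                  , (λ x y z → pointwise λ n → ℚ.*-distribʳ-+ (seq x n) (seq y n) (seq z n)) }
      ; *-comm = λ x y → pointwise λ n → ℚ.*-comm (seq x n) (seq y n) } }

  -- One rational comparison decides, at an index N after which the terms differ by less than ε / 4: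
  -- a term below ε / 2 keeps the sequence below ε, and any other term keeps it at least ε / 4.
  eventually-small : ∀ x ε → 0ℚ ℚ.< ε → Eventually (λ n → seq x n ℚ.< ε) ⊎ 0ℝ < x
  eventually-small x ε 0<ε with cauchy x (½ ℚ.* (½ ℚ.* ε)) (half-pos (half-pos 0<ε))
  ... | N , close with seq x N ℚ.<? ½ ℚ.* ε
  ... | yes small = inj₁ (N , λ n p → ℚ.<-trans
          (shift-<
            (solve 3 (λ a b e → (con ½ :* e :+ con ½ :* (con ½ :* e)) :- (a :+ (b :- a))
                        := (con ½ :* e :+ con ½ :* (con ½ :* e)) :- b)
              refl (seq x N) (seq x n) ε)
            (ℚ.+-mono-< small (ℚ.≤-<-trans (p≤∣p∣ (seq x n ℚ.- seq x N)) (close n N p ℕ.≤-refl))))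
          (shift-<
            (solve 1 (λ e → con ½ :* (con ½ :* e) :- con 0ℚ
                        := e :- (con ½ :* e :+ con ½ :* (con ½ :* e))) refl ε)
            (half-pos (half-pos 0<ε))))
  ... | no large = inj₂ (mk< (½ ℚ.* (½ ℚ.* ε)) (half-pos (half-pos 0<ε)) (N , λ n p →
          shift-≤
            (solve 3 (λ a b e → (a :+ con ½ :* (con ½ :* e)) :- (con ½ :* e :+ (a :- b))
                        := b :- (con 0ℚ :+ con ½ :* (con ½ :* e))) refl (seq x N) (seq x n) ε)
            (ℚ.+-mono-≤ (ℚ.≮⇒≥ large)
              (ℚ.<⇒≤ (ℚ.≤-<-trans (p≤∣p∣ (seq x N ℚ.- seq x n)) (close N n ℕ.≤-refl p))))))

  <⇒0<- : ∀ {x y} → x < y → 0ℝ < y - x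
  <⇒0<- {x} {y} (mk< g 0<g h) = mk< g 0<g (eventually-map (λ n → shift-≤
    (solve 3 (λ a b g → b :- (a :+ g) := (b :- a) :- (con 0ℚ :+ g)) refl (seq x n) (seq y n) g)) h)

  0<-⇒< : ∀ {x y} → 0ℝ < y - x → x < y
  0<-⇒< {x} {y} (mk< g 0<g h) = mk< g 0<g (eventually-map (λ n → shift-≤
    (solve 3 (λ a b g → (b :- a) :- (con 0ℚ :+ g) := b :- (a :+ g)) refl (seq x n) (seq y n) g)) h)

  <-irrefl-≈ : ∀ {x y} → x ≈ y → ¬ x < y
  <-irrefl-≈ {x} {y} (mk≈ h) (mk< g 0<g k) = eventually-refute
    (λ n (s , t) → ℚ.<-irrefl refl (ℚ.<-≤-trans
       (shift-< (solve 3 (λ a b g → g :- (:- (a :- b)) := (a :+ g) :- b) refl (seq x n) (seq y n) g)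
         (ℚ.≤-<-trans (-p≤∣p∣ (seq x n ℚ.- seq y n)) s)) t))
    (eventually-zip (λ _ → _,_) (h g 0<g) k)

  <-resp-≈ : ∀ {x y u v} → x ≈ y → u ≈ v → x < u → y < v
  <-resp-≈ {x} {y} {u} {v} (mk≈ h) (mk≈ k) (mk< g 0<g l) =
    -- Each of the two approximations costs at most a quarter of the gap.
    mk< (½ ℚ.* g) (half-pos 0<g)
      (eventually-zip (λ n (a , b) c → shift-≤
          (solve 5 (λ x y u v g →
              (con ½ :* (con ½ :* g) :+ (con ½ :* (con ½ :* g)) :+ u) :- ((:- (x :- y)) :+ (u :- v) :+ (x :+ g))
                := v :- (y :+ con ½ :* g))
            refl (seq x n) (seq y n) (seq u n) (seq v n) g)
          (ℚ.+-mono-≤ (ℚ.+-mono-≤ (ℚ.<⇒≤ (ℚ.≤-<-trans (-p≤∣p∣ (seq x n ℚ.- seq y n)) a))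
                                   (ℚ.<⇒≤ (ℚ.≤-<-trans (p≤∣p∣ (seq u n ℚ.- seq v n)) b))) c))
        (eventually-zip (λ _ → _,_) (h (½ ℚ.* (½ ℚ.* g)) (half-pos (half-pos 0<g)))
                                    (k (½ ℚ.* (½ ℚ.* g)) (half-pos (half-pos 0<g)))) l)

  ≤-resp-≈ : ∀ {x y u v} → x ≈ y → u ≈ v → x ≤ u → y ≤ v
  ≤-resp-≈ e f x≤u v<y = x≤u (<-resp-≈ (≈-sym f) (≈-sym e) v<y)

  ≤-reflexive : ∀ {x y} → x ≈ y → x ≤ y
  ≤-reflexive e = <-irrefl-≈ (≈-sym e)

  -- Neither difference is positive, so `eventually-small` puts both below every positive ε.
  ≤-antisym : ∀ {x y} → x ≤ y → y ≤ x → x ≈ y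
  ≤-antisym {x} {y} x≤y y≤x = mk≈ λ ε 0<ε → eventually-zip (λ n → combine (seq x n) (seq y n)) (lemma₁ ε 0<ε) (lemma₂ ε 0<ε)
    where
    combine : ∀ a b {ε} → a ℚ.- b ℚ.< ε → b ℚ.- a ℚ.< ε → ∣ a ℚ.- b ∣ ℚ.< ε
    combine a b {ε} h k = ∣∣-< h
      (subst (ℚ._< ε) (solve 2 (λ a b → b :- a := :- (a :- b)) refl a b) k)
    lemma₁ : ∀ ε → 0ℚ ℚ.< ε → Eventually λ n → seq x n ℚ.- seq y n ℚ.< ε
    lemma₁ ε 0<ε = [ (λ h → h) , (λ y<x → ⊥-elim (x≤y (0<-⇒< y<x))) ]′ (eventually-small (x - y) ε 0<ε)
    lemma₂ : ∀ ε → 0ℚ ℚ.< ε → Eventually λ n → seq y n ℚ.- seq x n ℚ.< ε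
    lemma₂ ε 0<ε = [ (λ h → h) , (λ x<y → ⊥-elim (y≤x (0<-⇒< x<y))) ]′ (eventually-small (y - x) ε 0<ε)

  <-asym : ∀ {x y} → x < y → x ≤ y
  <-asym {x} {y} (mk< g 0<g h) (mk< g′ 0<g′ h′) = eventually-refute
    (λ n (a , b) → ℚ.<-irrefl refl (ℚ.<-≤-trans (ℚ.+-mono-< 0<g 0<g′) (shift-≤
      (solve 4 (λ x y g g′ → (y :+ x) :- ((x :+ g) :+ (y :+ g′)) := (con 0ℚ :+ con 0ℚ) :- (g :+ g′))
        refl (seq x n) (seq y n) g g′) (ℚ.+-mono-≤ a b))))
    (eventually-zip (λ _ → _,_) h h′)

  ≤-total : ∀ x y → ¬ ¬ (x ≤ y ⊎ y < x)
  ≤-total x y k = k (inj₁ λ y<x → k (inj₂ y<x))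

  ≤⇒0≤- : ∀ {x y} → x ≤ y → 0ℝ ≤ y - x
  ≤⇒0≤- {x} {y} x≤y h = x≤y (0<-⇒< (<-resp-≈ ≈-refl
    (pointwise λ n → solve 2 (λ a b → con 0ℚ :- (b :- a) := a :- b) refl (seq x n) (seq y n)) (<⇒0<- h)))

  0≤-⇒≤ : ∀ {x y} → 0ℝ ≤ y - x → x ≤ y
  0≤-⇒≤ {x} {y} h y<x = h (0<-⇒< (<-resp-≈ ≈-refl
    (pointwise λ n → solve 2 (λ a b → a :- b := con 0ℚ :- (b :- a)) refl (seq x n) (seq y n)) (<⇒0<- y<x)))

  0≤-+ : ∀ {x y} → 0ℝ ≤ x → 0ℝ ≤ y → 0ℝ ≤ x + y
  0≤-+ {x} {y} 0≤x 0≤y (mk< g 0<g h) = eventually-refute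
    (λ n ((a , b) , c) → ℚ.<-irrefl refl (ℚ.<-≤-trans (shift-<
      (solve 3 (λ x y g → (con ½ :* g :+ con ½ :* g) :- (:- x :+ :- y) := (x :+ y :+ g) :- con 0ℚ)
        refl (seq x n) (seq y n) g) (ℚ.+-mono-< a b)) c))
    (eventually-zip (λ _ → _,_) (eventually-zip (λ _ → _,_) (small x 0≤x) (small y 0≤y)) h)
    where
    small : ∀ z → 0ℝ ≤ z → Eventually λ n → ℚ.- seq z n ℚ.< ½ ℚ.* g
    small z 0≤z = [ (λ s → s)
      , (λ 0<-z → ⊥-elim (0≤z (0<-⇒< (<-resp-≈ ≈-refl
          (pointwise λ n → solve 1 (λ a → :- a := con 0ℚ :- a) refl (seq z n)) 0<-z)))) ]′
      (eventually-small (- z) (½ ℚ.* g) (half-pos 0<g))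

  0<-* : ∀ {x y} → 0ℝ < x → 0ℝ < y → 0ℝ < x * y
  0<-* {x} {y} (mk< g 0<g h) (mk< g′ 0<g′ h′) = mk< (g ℚ.* g′) (*-pos 0<g 0<g′)
    (eventually-zip (λ n a b → subst (ℚ._≤ seq x n ℚ.* seq y n) (≡.sym (ℚ.+-identityˡ (g ℚ.* g′)))
        (let a′ = subst (ℚ._≤ seq x n) (ℚ.+-identityˡ g) a
             b′ = subst (ℚ._≤ seq y n) (ℚ.+-identityˡ g′) b
         in *-mono-≤ (ℚ.<⇒≤ 0<g′) (ℚ.≤-trans (ℚ.<⇒≤ 0<g) a′) a′ b′)) h h′)

  -- The goal is a negation, which permits a case distinction on the signs; a nonnegative factor
  -- that is not positive vanishes.
  0≤-* : ∀ {x y} → 0ℝ ≤ x → 0ℝ ≤ y → 0ℝ ≤ x * y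
  0≤-* {x} {y} 0≤x 0≤y xy<0 =
    ≤-total x 0ℝ λ
      { (inj₁ x≤0) → ≤-reflexive (≈-trans
          (pointwise λ n → solve 1 (λ b → con 0ℚ := con 0ℚ :* b) refl (seq y n))
          (*-cong (≤-antisym 0≤x x≤0) ≈-refl)) xy<0
      ; (inj₂ 0<x) → ≤-total y 0ℝ λ
          { (inj₁ y≤0) → ≤-reflexive (≈-trans
              (pointwise λ n → solve 1 (λ a → con 0ℚ := a :* con 0ℚ) refl (seq x n))
              (*-cong ≈-refl (≤-antisym 0≤y y≤0))) xy<0
          ; (inj₂ 0<y) → <-asym (0<-* 0<x 0<y) xy<0 } }

  abstract
    inverse : ∀ {x} → 0ℝ < x → ∃[ y ] (0ℝ ≤ y × x * y ≈ 1ℝ)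
    inverse {x} (mk< g 0<g h) = mkℝ r r-cauchy , r≥0 , mk≈ (λ ε 0<ε → eventually-map
        (λ n a → subst (λ p → ∣ p ∣ ℚ.< ε) (≡.sym (diff n a)) 0<ε) h)
      where
      -- Eventually m n = seq x n; the maximum only keeps the division defined.
      m : ℕ → ℚ
      m n = seq x n ℚ.⊔ g
      g≤m : ∀ n → g ℚ.≤ m n
      g≤m n = ℚ.p≤q⊔p (seq x n) g
      0<m : ∀ n → 0ℚ ℚ.< m n
      0<m n = ℚ.<-≤-trans 0<g (g≤m n)
      r : ℕ → ℚ
      r n = proj₁ (reciprocal (m n) (0<m n))
      0<r : ∀ n → 0ℚ ℚ.< r n
      0<r n = proj₁ (proj₂ (reciprocal (m n) (0<m n)))
      mr≡1 : ∀ n → m n ℚ.* r n ≡ 1ℚ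
      mr≡1 n = proj₂ (proj₂ (reciprocal (m n) (0<m n)))
      k : ℚ
      k = proj₁ (reciprocal g 0<g)
      0<k : 0ℚ ℚ.< k
      0<k = proj₁ (proj₂ (reciprocal g 0<g))
      gk≡1 : g ℚ.* k ≡ 1ℚ
      gk≡1 = proj₂ (proj₂ (reciprocal g 0<g))
      r≤k : ∀ n → r n ℚ.≤ k
      r≤k n = subst₂ ℚ._≤_
        (≡.trans (solve 3 (λ g k r → g :* k :* r := g :* k :* r) refl g k (r n))
          (≡.trans (cong (ℚ._* r n) gk≡1) (ℚ.*-identityˡ (r n))))
        (≡.trans (solve 3 (λ m k r → m :* k :* r := m :* r :* k) refl (m n) k (r n))
          (≡.trans (cong (ℚ._* k) (mr≡1 n)) (ℚ.*-identityˡ k)))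
        (ℚ.*-monoʳ-≤-nonNeg (r n) {{ℚ.nonNegative (ℚ.<⇒≤ (0<r n))}}
          (ℚ.*-monoʳ-≤-nonNeg k {{ℚ.nonNegative (ℚ.<⇒≤ 0<k)}} (g≤m n)))
      m≡x : ∀ n → 0ℚ ℚ.+ g ℚ.≤ seq x n → m n ≡ seq x n
      m≡x n a = ℚ.p≥q⇒p⊔q≡p (subst (ℚ._≤ seq x n) (ℚ.+-identityˡ g) a)
      diff : ∀ n → 0ℚ ℚ.+ g ℚ.≤ seq x n → seq x n ℚ.* r n ℚ.- 1ℚ ≡ 0ℚ
      diff n a = ≡.trans (cong (λ p → p ℚ.* r n ℚ.- 1ℚ) (≡.sym (m≡x n a)))
        (≡.trans (cong (ℚ._- 1ℚ) (mr≡1 n)) (ℚ.+-inverseʳ 1ℚ))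
      r-diff : ∀ i j → r i ℚ.- r j ≡ r i ℚ.* r j ℚ.* (m j ℚ.- m i)
      r-diff i j = ≡.trans
        (≡.sym (cong₂ ℚ._-_ (≡.trans (cong (r i ℚ.*_) (mr≡1 j)) (ℚ.*-identityʳ (r i)))
                            (≡.trans (cong (r j ℚ.*_) (mr≡1 i)) (ℚ.*-identityʳ (r j)))))
        (solve 4 (λ a b c d → a :* (d :* b) :- b :* (c :* a) := a :* b :* (d :- c)) refl
          (r i) (r j) (m i) (m j))
      r-cauchy : IsCauchy r
      -- By `r-diff` a difference of reciprocals is that of the terms times two reciprocals, each at
      -- most k = 1 / g; the factor g² compensates for k².
      r-cauchy ε 0<ε with cauchy x (g ℚ.* g ℚ.* ε) (*-pos (*-pos 0<g 0<g) 0<ε)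
      ... | M , close = M ℕ.⊔ proj₁ h , λ i j p q →
        let N = proj₁ h
            big = proj₂ h
            mi = m≡x i (big i (ℕ.m⊔n≤o⇒n≤o M N p))
            mj = m≡x j (big j (ℕ.m⊔n≤o⇒n≤o M N q))
            0≤rr = ℚ.<⇒≤ (*-pos (0<r i) (0<r j))
        in begin-strict
        ∣ r i ℚ.- r j ∣                              ≡⟨ cong ∣_∣ (r-diff i j) ⟩
        ∣ r i ℚ.* r j ℚ.* (m j ℚ.- m i) ∣            ≡⟨ ℚ.∣p*q∣≡∣p∣*∣q∣ (r i ℚ.* r j) (m j ℚ.- m i) ⟩
        ∣ r i ℚ.* r j ∣ ℚ.* ∣ m j ℚ.- m i ∣
          ≡⟨ cong₂ (λ a b → a ℚ.* ∣ b ∣) (ℚ.0≤p⇒∣p∣≡p 0≤rr) (cong₂ ℚ._-_ mj mi) ⟩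
        r i ℚ.* r j ℚ.* ∣ seq x j ℚ.- seq x i ∣
          ≤⟨ ℚ.*-monoʳ-≤-nonNeg ∣ seq x j ℚ.- seq x i ∣ {{ℚ.∣-∣-nonNeg (seq x j ℚ.- seq x i)}}
               (*-mono-≤ (ℚ.<⇒≤ (0<r j)) (ℚ.<⇒≤ 0<k) (r≤k i) (r≤k j)) ⟩
        k ℚ.* k ℚ.* ∣ seq x j ℚ.- seq x i ∣
          <⟨ ℚ.*-monoʳ-<-pos (k ℚ.* k) {{ℚ.positive (*-pos 0<k 0<k)}}
               (close j i (ℕ.m⊔n≤o⇒m≤o M N q) (ℕ.m⊔n≤o⇒m≤o M N p)) ⟩
        k ℚ.* k ℚ.* (g ℚ.* g ℚ.* ε)
          ≡⟨ solve 3 (λ k g e → k :* k :* (g :* g :* e) := (g :* k) :* (g :* k) :* e) refl k g ε ⟩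
        (g ℚ.* k) ℚ.* (g ℚ.* k) ℚ.* ε                ≡⟨ cong (λ p → p ℚ.* p ℚ.* ε) gk≡1 ⟩
        1ℚ ℚ.* 1ℚ ℚ.* ε                              ≡⟨ ℚ.*-identityˡ ε ⟩
        ε                                            ∎
        where open ℚ.≤-Reasoning
      r≥0 : 0ℝ ≤ mkℝ r r-cauchy
      r≥0 (mk< g′ 0<g′ h′) = eventually-refute (λ n a → ℚ.<-irrefl refl
        (ℚ.<-≤-trans (ℚ.+-mono-< (0<r n) 0<g′) a)) h′

-- Ring identities and signs of reals up to double negation

open CommutativeRing ℝ-commutativeRing using (+-commutativeMonoid; semiring; setoid)
module ℝ-Sum = Algebra.Properties.CommutativeMonoid.Sum +-commutativeMonoid
module ℝ-Product = Algebra.Properties.Semiring.Sum semiring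
module ≈-Reasoning = SetoidReasoning setoid

fromℚ-equal? : ∀ p q → Maybe (fromℚ p ≈ fromℚ q)
fromℚ-equal? p q with p ℚ.≟ q
... | yes refl = just ≈-refl
... | no _ = nothing

fromℚ-homomorphism :
  CommutativeRing.rawRing ℚ.+-*-commutativeRing -Raw-AlmostCommutative⟶ fromCommutativeRing ℝ-commutativeRing
fromℚ-homomorphism = record
  { ⟦_⟧ = fromℚ
  ; +-homo = λ _ _ → pointwise λ _ → refl
  ; *-homo = λ _ _ → pointwise λ _ → refl
  ; -‿homo = λ _ → pointwise λ _ → refl
  ; 0-homo = ≈-refl
  ; 1-homo = ≈-refl }

module ℝ-Solver = Algebra.Solver.Ring
  (CommutativeRing.rawRing ℚ.+-*-commutativeRing)
  (fromCommutativeRing ℝ-commutativeRing)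
  fromℚ-homomorphism
  fromℚ-equal?

open ℝ-Solver using (Polynomial; solve; _:=_; _:+_; _:*_; :-_; _:-_; con)

-- By definition this is the double negation of `0ℝ < x`: positivity without a gap at hand, as
-- classical reasoning provides it.
Pos : ℝ → Set
Pos x = ¬ x ≤ 0ℝ

<⇒Pos : ∀ {x} → 0ℝ < x → Pos x
<⇒Pos 0<x x≤0 = x≤0 0<x

Pos⇒0≤ : ∀ {x} → Pos x → 0ℝ ≤ x
Pos⇒0≤ p = p >>= <-asym

Pos-resp : ∀ {x y} → x ≈ y → Pos x → Pos y
Pos-resp e p y≤0 = p (≤-resp-≈ (≈-sym e) ≈-refl y≤0)

0≤-resp : ∀ {x y} → x ≈ y → 0ℝ ≤ x → 0ℝ ≤ y
0≤-resp e = ≤-resp-≈ ≈-refl e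

0≤-neg : ∀ {x} → x ≤ 0ℝ → 0ℝ ≤ - x
0≤-neg {x} h = 0≤-resp (solve 1 (λ x → con 0ℚ :- x := :- x) ≈-refl x) (≤⇒0≤- h)

neg-0≤ : ∀ {x} → 0ℝ ≤ - x → x ≤ 0ℝ
neg-0≤ {x} h = 0≤-⇒≤ (0≤-resp (solve 1 (λ x → :- x := con 0ℚ :- x) ≈-refl x) h)

≤-trans : ∀ {x y z} → x ≤ y → y ≤ z → x ≤ z
≤-trans {x} {y} {z} h k = 0≤-⇒≤ (0≤-resp
  (solve 3 (λ x y z → (y :- x) :+ (z :- y) := z :- x) ≈-refl x y z)
  (0≤-+ (≤⇒0≤- h) (≤⇒0≤- k)))

Pos-+ : ∀ {x y} → 0ℝ ≤ x → Pos y → Pos (x + y)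
Pos-+ {x} {y} 0≤x p h = p (≤-trans (0≤-⇒≤ (0≤-resp
  (solve 2 (λ x y → x := (x :+ y) :- y) ≈-refl x y) 0≤x)) h)

Pos-* : ∀ {x y} → Pos x → Pos y → Pos (x * y)
Pos-* p q h = p λ 0<x → q λ 0<y → h (0<-* 0<x 0<y)

0≤-cancel : ∀ {s x} → Pos s → 0ℝ ≤ s * x → 0ℝ ≤ x
-- The goal is a negation, so a gap for s may be extracted, and s inverted.
0≤-cancel {s} {x} p h = p >>= λ 0<s → let (r , 0≤r , sr≈1) = inverse 0<s in
  0≤-resp (begin
    r * (s * x)   ≈⟨ solve 3 (λ r s x → r :* (s :* x) := s :* r :* x) ≈-refl r s x ⟩
    s * r * x     ≈⟨ *-cong sr≈1 ≈-refl ⟩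
    1ℝ * x        ≈⟨ solve 1 (λ x → con 1ℚ :* x := x) ≈-refl x ⟩
    x             ∎) (0≤-* 0≤r h)
  where open ≈-Reasoning

0≤-square : ∀ x → 0ℝ ≤ x * x
0≤-square x = ≤-total x 0ℝ >>= λ
  { (inj₁ x≤0) → 0≤-resp (solve 1 (λ x → :- x :* :- x := x :* x) ≈-refl x)
      (0≤-* (0≤-neg x≤0) (0≤-neg x≤0))
  ; (inj₂ 0<x) → <-asym (0<-* 0<x 0<x) }

square≤0 : ∀ {x} → x * x ≤ 0ℝ → x ≈ 0ℝ
square≤0 {x} h = ≤-antisym
  (λ 0<x → h (0<-* 0<x 0<x))
  (λ x<0 → h (<-resp-≈ ≈-refl
    (solve 1 (λ x → (con 0ℚ :- x) :* (con 0ℚ :- x) := x :* x) ≈-refl x) (0<-* (<⇒0<- x<0) (<⇒0<- x<0))))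

≈0-cancel : ∀ {s x} → Pos s → s * x ≈ 0ℝ → x ≈ 0ℝ
≈0-cancel {s} {x} p e = ≤-antisym
  (neg-0≤ (0≤-cancel p (≤-reflexive (≈-sym (≈-trans
    (solve 2 (λ s x → s :* :- x := :- (s :* x)) ≈-refl s x)
    (≈-trans (neg-cong e) (solve 0 (:- con 0ℚ := con 0ℚ) ≈-refl)))))))
  (0≤-cancel p (≤-reflexive (≈-sym e)))

-- The nonnegative cone of the lexicographic order on ℝ².
Lex : ℝ → ℝ → Set
Lex α β = 0ℝ ≤ α × (α ≤ 0ℝ → 0ℝ ≤ β)

lex-resp : ∀ {α β α′ β′} → α ≈ α′ → β ≈ β′ → Lex α β → Lex α′ β′
lex-resp e f (h , k) = 0≤-resp e h , λ α′≤0 → 0≤-resp f (k (≤-resp-≈ (≈-sym e) ≈-refl α′≤0))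

lex-0 : Lex 0ℝ 0ℝ
lex-0 = ≤-reflexive ≈-refl , λ _ → ≤-reflexive ≈-refl

lex-+ : ∀ {α β α′ β′} → Lex α β → Lex α′ β′ → Lex (α + α′) (β + β′)
lex-+ {α} {β} {α′} {β′} (h , k) (h′ , k′) = 0≤-+ h h′ , λ s≤0 → 0≤-+
  (k (≤-trans (0≤-⇒≤ (0≤-resp (solve 2 (λ a b → b := a :+ b :- a) ≈-refl α α′) h′)) s≤0))
  (k′ (≤-trans (0≤-⇒≤ (0≤-resp (solve 2 (λ a b → a := a :+ b :- b) ≈-refl α α′) h)) s≤0))

lex-* : ∀ {c α β} → 0ℝ ≤ c → Lex α β → Lex (c * α) (c * β)
lex-* {c} {α} {β} 0≤c (h , k) = 0≤-* 0≤c h , λ cα≤0 → ≤-total c 0ℝ >>= λ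
  { (inj₁ c≤0) → ≤-reflexive (≈-trans (solve 1 (λ β → con 0ℚ := con 0ℚ :* β) ≈-refl β)
      (*-cong (≤-antisym 0≤c c≤0) ≈-refl))
  ; (inj₂ 0<c) → 0≤-* 0≤c (k (neg-0≤ (0≤-cancel (<⇒Pos 0<c)
      (0≤-resp (solve 2 (λ c α → :- (c :* α) := c :* :- α) ≈-refl c α) (0≤-neg cα≤0))))) }

lex-cancel : ∀ {c α β} → Pos c → Lex (c * α) (c * β) → Lex α β
lex-cancel {c} {α} p (h , k) = 0≤-cancel p h , λ α≤0 → 0≤-cancel p (k (neg-0≤ (0≤-resp
  (solve 2 (λ c α → c :* :- α := :- (c :* α)) ≈-refl c α) (0≤-* (Pos⇒0≤ p) (0≤-neg α≤0)))))

lex-total : ∀ α β → ¬ ¬ (Lex α β ⊎ Lex (- α) (- β))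
lex-total α β k = ≤-total 0ℝ α λ
  { (inj₂ α<0) → k (inj₂ (0≤-neg (<-asym α<0) , λ -α≤0 _ → -α≤0 (<-resp-≈ ≈-refl
      (solve 1 (λ α → con 0ℚ :- α := :- α) ≈-refl α) (<⇒0<- α<0))))
  ; (inj₁ 0≤α) → ≤-total 0ℝ β λ
    { (inj₁ 0≤β) → k (inj₁ (0≤α , λ _ → 0≤β))
    ; (inj₂ β<0) → ≤-total α 0ℝ λ
      { (inj₁ α≤0) → k (inj₂ (0≤-neg α≤0 , λ _ → 0≤-neg (<-asym β<0)))
      ; (inj₂ 0<α) → k (inj₁ (0≤α , λ α≤0 _ → α≤0 0<α)) } } }

lex-sum : ∀ {m} (w α β : Fin m → ℝ) → (∀ i → 0ℝ ≤ w i) → (∀ i → Lex (α i) (β i)) →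
  Lex (sum λ i → w i * α i) (sum λ i → w i * β i)
lex-sum {ℕ.zero} w α β 0≤w h = lex-0
lex-sum {ℕ.suc m} w α β 0≤w h = lex-+ (lex-* (0≤w zero) (h zero))
  (lex-sum (λ i → w (suc i)) (λ i → α (suc i)) (λ i → β (suc i))
    (λ i → 0≤w (suc i)) (λ i → h (suc i)))

sum-nonneg : ∀ {m} (w : Fin m → ℝ) → (∀ i → 0ℝ ≤ w i) → 0ℝ ≤ sum w
sum-nonneg {ℕ.zero} w h = ≤-reflexive ≈-refl
sum-nonneg {ℕ.suc m} w h = 0≤-+ (h zero) (sum-nonneg (λ i → w (suc i)) (λ i → h (suc i)))

-- Lexicographic orders on the plane

infix 4 _⊑[_,_]_

-- Points are compared by their height above the direction u, and ties are broken by `cross v`. With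
-- `rot u` for v, this second form is the position along u.
_⊑[_,_]_ : Point → Point → Point → Point → Set
p ⊑[ u , v ] q = Lex (cross u (q -ₚ p)) (cross v (q -ₚ p))

:cross : ∀ {n} (a b c d : Polynomial n) → Polynomial n
:cross a b c d = a :* d :- b :* c

cross-telescope : ∀ u p q r → cross u (q -ₚ p) + cross u (r -ₚ q) ≈ cross u (r -ₚ p)
cross-telescope (a ,ₚ b) (c ,ₚ d) (e ,ₚ f) (g ,ₚ h) = solve 8 (λ a b c d e f g h →
  :cross a b (e :- c) (f :- d) :+ :cross a b (g :- e) (h :- f) := :cross a b (g :- c) (h :- d))
  ≈-refl a b c d e f g h

cross-swap : ∀ u p q → - cross u (q -ₚ p) ≈ cross u (p -ₚ q)
cross-swap (a ,ₚ b) (c ,ₚ d) (e ,ₚ f) = solve 6 (λ a b c d e f →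
  :- :cross a b (e :- c) (f :- d) := :cross a b (c :- e) (d :- f))
  ≈-refl a b c d e f

⊑-trans : ∀ {u v p q r} → p ⊑[ u , v ] q → q ⊑[ u , v ] r → p ⊑[ u , v ] r
⊑-trans {u} {v} {p} {q} {r} h k =
  lex-resp (cross-telescope u p q r) (cross-telescope v p q r) (lex-+ h k)

⊑-total : ∀ u v p q → ¬ ¬ (p ⊑[ u , v ] q ⊎ q ⊑[ u , v ] p)
⊑-total u v p q k = lex-total (cross u (q -ₚ p)) (cross v (q -ₚ p)) λ
  { (inj₁ h) → k (inj₁ h)
  ; (inj₂ h) → k (inj₂ (lex-resp (cross-swap u p q) (cross-swap v p q) h)) }

-- An affine function commutes with convex combinations: the weights sum to one, which accounts for
-- its constant term.
cross-hull : ∀ {m} {v : Fin m → Point} {c} u x (h : hull v c) →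
  sum (λ i → proj₁ h i * cross u (v i -ₚ x)) ≈ cross u (c -ₚ x)
cross-hull {m} {v} {cx ,ₚ cy} (a ,ₚ b) (x ,ₚ y) (w , 0≤w , Σw , Σx , Σy) = begin
  sum (λ i → w i * cross (a ,ₚ b) (v i -ₚ (x ,ₚ y)))
    ≈⟨ ℝ-Sum.sum-cong-≋ (λ i → solve 7 (λ a b x y p q w →
         w :* :cross a b (p :- x) (q :- y) :=
           a :* (w :* q) :+ (:- b :* (w :* p) :+ :- :cross a b x y :* w))
         ≈-refl a b x y (x-coord (v i)) (y-coord (v i)) (w i)) ⟩
  sum (λ i → a * wy i + (- b * wx i + - k * w i))
    ≈⟨ ℝ-Sum.∑-distrib-+ (λ i → a * wy i) (λ i → - b * wx i + - k * w i) ⟩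
  sum (λ i → a * wy i) + sum (λ i → - b * wx i + - k * w i)
    ≈⟨ +-cong ≈-refl (ℝ-Sum.∑-distrib-+ (λ i → - b * wx i) (λ i → - k * w i)) ⟩
  sum (λ i → a * wy i) + (sum (λ i → - b * wx i) + sum (λ i → - k * w i))
    ≈⟨ +-cong (ℝ-Product.*-distribˡ-sum a wy)
         (+-cong (ℝ-Product.*-distribˡ-sum (- b) wx) (ℝ-Product.*-distribˡ-sum (- k) w)) ⟨
  a * sum wy + (- b * sum wx + - k * sum w)
    ≈⟨ +-cong (*-cong (≈-refl {a}) Σy)
         (+-cong (*-cong (≈-refl { - b }) Σx) (*-cong (≈-refl { - k }) (≈-sym Σw))) ⟨
  a * cy + (- b * cx + - k * 1ℝ)
    ≈⟨ solve 6 (λ a b x y p q → a :* q :+ (:- b :* p :+ :- :cross a b x y :* con 1ℚ) :=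
         :cross a b (p :- x) (q :- y)) ≈-refl a b x y cx cy ⟩
  cross (a ,ₚ b) ((cx ,ₚ cy) -ₚ (x ,ₚ y)) ∎
  where
  open ≈-Reasoning
  wx wy : Fin m → ℝ
  wx i = w i * x-coord (v i)
  wy i = w i * y-coord (v i)
  k : ℝ
  k = cross (a ,ₚ b) (x ,ₚ y)

-- A lexicographic half-plane is convex, since the weights of c serve both coordinates of the order.
below-hull : ∀ {m} {g : Fin m → Point} {u v x c} →
  (∀ i → x ⊑[ u , v ] g i) → c ∈ₚ hull g → x ⊑[ u , v ] c
below-hull {g = g} {u} {v} {x} h c∈ = lex-resp (cross-hull u x c∈) (cross-hull v x c∈)
  (lex-sum (proj₁ c∈) (λ i → cross u (g i -ₚ x)) (λ i → cross v (g i -ₚ x)) (proj₁ (proj₂ c∈)) h)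

-- Extremal points and convex hulls

-- The elements of the list are inserted one at a time. Transitivity is required on G only, because
-- `leftmost` compares angles by a relation shown transitive only there.
select : ∀ {A : Set} {G : A → Set} (R : A → A → Set) →
  (∀ a b → ¬ ¬ (R a b ⊎ R b a)) →
  (∀ {a b c} → G a → G b → G c → R a b → R b c → R a c) →
  ∀ xs a → G a → ¬ ¬ (∃[ b ] (G b × R b a × (∀ x → x ∈ₗ xs → G x → R b x)))
-- Totality applied to a twice gives reflexivity.
select R total tr [] a ga k = total a a λ r → k (a , ga , [ id , id ]′ r , λ _ ())
select {A} {G} R total tr (x ∷ xs) a ga k = select R total tr xs a ga λ (b , gb , rba , h) →
  ¬¬-excluded-middle {A = G x} λ
    { (no ¬gx) → k (b , gb , rba , λ { y (here refl) gy → ⊥-elim (¬gx gy)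
                                     ; y (there y∈) gy → h y y∈ gy })
    ; (yes gx) → total b x λ
      { (inj₁ rbx) → k (b , gb , rba , λ { y (here refl) gy → rbx ; y (there y∈) gy → h y y∈ gy })
      ; (inj₂ rxb) → total x x λ rxx → k (x , gx , tr gx gb ga rxb rba
          , λ { y (here refl) gy → [ id , id ]′ rxx
              ; y (there y∈) gy → tr gx gb gy rxb (h y y∈ gy) }) } }

minimum : ∀ {A : Set} (xs : List A) → (∀ x → x ∈ₗ xs) → A → (g : A → Point) → ∀ u v →
  ¬ ¬ (∃[ x ] (∀ y → g x ⊑[ u , v ] g y))
minimum xs complete a g u v k = select {G = λ _ → ⊤} (λ x y → g x ⊑[ u , v ] g y)
  (λ x y → ⊑-total u v (g x) (g y)) (λ {x} {y} {z} _ _ _ → ⊑-trans {u} {v} {g x} {g y} {g z})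
  xs a tt λ (x , _ , _ , h) → k (x , λ y → h y (complete y) tt)

opposite rot : Point → Point
opposite p = (- x-coord p) ,ₚ (- y-coord p)
rot p = y-coord p ,ₚ (- x-coord p)

-- This unfolds to the scalar product, as `rot` is a clockwise quarter turn. Written through
-- `cross`, it inherits the lemmas on cross products.
dot : Point → Point → ℝ
dot u v = cross (rot u) v

cross-opposite : ∀ u p q → cross u (q -ₚ p) ≈ cross (opposite u) (p -ₚ q)
cross-opposite (a ,ₚ b) (c ,ₚ d) (e ,ₚ f) = solve 6 (λ a b c d e f →
  :cross a b (e :- c) (f :- d) := :cross (:- a) (:- b) (c :- e) (d :- f)) ≈-refl a b c d e f

⊑-opposite : ∀ {u v p q} → p ⊑[ u , v ] q → q ⊑[ opposite u , opposite v ] p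
⊑-opposite {u} {v} {p} {q} = lex-resp (cross-opposite u p q) (cross-opposite v p q)

opposite-⊑ : ∀ {u v p q} → q ⊑[ opposite u , opposite v ] p → p ⊑[ u , v ] q
opposite-⊑ {u} {v} {p} {q} = lex-resp (≈-sym (cross-opposite u p q)) (≈-sym (cross-opposite v p q))

above-hull : ∀ {m} {g : Fin m → Point} {u v x c} →
  (∀ i → g i ⊑[ u , v ] x) → c ∈ₚ hull g → c ⊑[ u , v ] x
above-hull {g = g} {u} {v} {x} {c} h c∈ = opposite-⊑ {u} {v} {c} {x}
  (below-hull {g = g} {opposite u} {opposite v} {x} {c} (λ i → ⊑-opposite {u} {v} {g i} {x} (h i)) c∈)

indicator : ∀ {m} → Fin m → Fin m → ℝ
indicator zero    zero    = 1ℝ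
indicator zero    (suc j) = 0ℝ
indicator (suc i) zero    = 0ℝ
indicator (suc i) (suc j) = indicator i j

0≤1 : 0ℝ ≤ 1ℝ
0≤1 = 0≤-resp (solve 0 (con 1ℚ :* con 1ℚ := con 1ℚ) ≈-refl) (0≤-square 1ℝ)

indicator-nonneg : ∀ {m} (i j : Fin m) → 0ℝ ≤ indicator i j
indicator-nonneg zero    zero    = 0≤1
indicator-nonneg zero    (suc j) = ≤-reflexive ≈-refl
indicator-nonneg (suc i) zero    = ≤-reflexive ≈-refl
indicator-nonneg (suc i) (suc j) = indicator-nonneg i j

sum-indicator : ∀ {m} (i : Fin m) (z : Fin m → ℝ) → sum (λ j → indicator i j * z j) ≈ z i
sum-indicator {ℕ.suc m} zero z = begin
  1ℝ * z zero + sum (λ j → 0ℝ * z (suc j))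
    ≈⟨ +-cong (≈-refl {1ℝ * z zero}) (ℝ-Product.*-distribˡ-sum 0ℝ (λ j → z (suc j))) ⟨
  1ℝ * z zero + 0ℝ * sum (λ j → z (suc j))
    ≈⟨ solve 2 (λ a b → con 1ℚ :* a :+ con 0ℚ :* b := a) ≈-refl (z zero) (sum (λ j → z (suc j))) ⟩
  z zero ∎
  where open ≈-Reasoning
sum-indicator (suc i) z = begin
  0ℝ * z zero + sum (λ j → indicator i j * z (suc j))
    ≈⟨ +-cong (≈-refl {0ℝ * z zero}) (sum-indicator i (λ j → z (suc j))) ⟩
  0ℝ * z zero + z (suc i)
    ≈⟨ solve 2 (λ a b → con 0ℚ :* a :+ b := b) ≈-refl (z zero) (z (suc i)) ⟩
  z (suc i) ∎
  where open ≈-Reasoning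

sum-*1 : ∀ {m} (w : Fin m → ℝ) → sum (λ i → w i * 1ℝ) ≈ sum w
sum-*1 w = ℝ-Sum.sum-cong-≋ λ i → solve 1 (λ a → a :* con 1ℚ := a) ≈-refl (w i)

generator∈hull : ∀ {m} (g : Fin m → Point) i → g i ∈ₚ hull g
generator∈hull g i = indicator i , indicator-nonneg i
  , ≈-trans (≈-sym (sum-*1 (indicator i))) (sum-indicator i (λ _ → 1ℝ))
  , ≈-sym (sum-indicator i (λ j → x-coord (g j)))
  , ≈-sym (sum-indicator i (λ j → y-coord (g j)))

sum-assoc : ∀ {m n} (w : Fin m → ℝ) (u : Fin m → Fin n → ℝ) (z : Fin n → ℝ) →
  sum (λ i → w i * sum (λ j → u i j * z j)) ≈ sum (λ j → sum (λ i → w i * u i j) * z j)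
sum-assoc w u z = begin
  sum (λ i → w i * sum (λ j → u i j * z j))
    ≈⟨ ℝ-Sum.sum-cong-≋ (λ i → ℝ-Product.*-distribˡ-sum (w i) (λ j → u i j * z j)) ⟩
  sum (λ i → sum (λ j → w i * (u i j * z j)))
    ≈⟨ ℝ-Sum.∑-comm (λ i j → w i * (u i j * z j)) ⟩
  sum (λ j → sum (λ i → w i * (u i j * z j)))
    ≈⟨ ℝ-Sum.sum-cong-≋ (λ j → ℝ-Sum.sum-cong-≋ (λ i →
         solve 3 (λ a b c → a :* (b :* c) := a :* b :* c) ≈-refl (w i) (u i j) (z j))) ⟩
  sum (λ j → sum (λ i → w i * u i j * z j))
    ≈⟨ ℝ-Sum.sum-cong-≋ (λ j → ℝ-Product.*-distribʳ-sum (z j) (λ i → w i * u i j)) ⟨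
  sum (λ j → sum (λ i → w i * u i j) * z j) ∎
  where open ≈-Reasoning

hull-closed : ∀ {m n} {g : Fin m → Point} {q : Fin n → Point} {c} →
  (∀ i → q i ∈ₚ hull g) → c ∈ₚ hull q → c ∈ₚ hull g
hull-closed {m} {n} {g} {q} {c} q∈ (w , 0≤w , Σw , Σx , Σy) = W
  , (λ j → sum-nonneg (λ i → w i * u i j) (λ i → 0≤-* (0≤w i) (proj₁ (proj₂ (q∈ i)) j)))
  , (begin
      sum W                                           ≈⟨ sum-*1 W ⟨
      sum (λ j → W j * 1ℝ)                            ≈⟨ sum-assoc w u (λ _ → 1ℝ) ⟨
      sum (λ i → w i * sum (λ j → u i j * 1ℝ))
        ≈⟨ ℝ-Sum.sum-cong-≋ (λ i → *-cong (≈-refl {w i})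
             (≈-trans (sum-*1 (u i)) (proj₁ (proj₂ (proj₂ (q∈ i)))))) ⟩
      sum (λ i → w i * 1ℝ)                            ≈⟨ sum-*1 w ⟩
      sum w                                           ≈⟨ Σw ⟩
      1ℝ                                              ∎)
  , coordinate x-coord (λ i → proj₁ (proj₂ (proj₂ (proj₂ (q∈ i))))) Σx
  , coordinate y-coord (λ i → proj₂ (proj₂ (proj₂ (proj₂ (q∈ i))))) Σy
  where
  open ≈-Reasoning
  u : Fin n → Fin m → ℝ
  u i = proj₁ (q∈ i)
  W : Fin m → ℝ
  W j = sum (λ i → w i * u i j)
  coordinate : (f : Point → ℝ) → (∀ i → f (q i) ≈ sum (λ j → u i j * f (g j))) →
    f c ≈ sum (λ i → w i * f (q i)) → f c ≈ sum (λ j → W j * f (g j))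
  coordinate f h Σf = begin
    f c                                                 ≈⟨ Σf ⟩
    sum (λ i → w i * f (q i))
      ≈⟨ ℝ-Sum.sum-cong-≋ (λ i → *-cong (≈-refl {w i}) (h i)) ⟩
    sum (λ i → w i * sum (λ j → u i j * f (g j)))       ≈⟨ sum-assoc w u (λ j → f (g j)) ⟩
    sum (λ j → W j * f (g j))                           ∎

-- Common points of two hulls

sum-difference : ∀ {k} (w a b : Fin k → ℝ) →
  sum (λ i → w i * (a i - b i)) ≈ 0ℝ → sum (λ i → w i * a i) ≈ sum (λ i → w i * b i)
sum-difference w a b h = begin
  sum (λ i → w i * a i)
    ≈⟨ ℝ-Sum.sum-cong-≋ (λ i → solve 3 (λ w a b →
         w :* a := w :* b :+ w :* (a :- b)) ≈-refl (w i) (a i) (b i)) ⟩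
  sum (λ i → w i * b i + w i * (a i - b i))
    ≈⟨ ℝ-Sum.∑-distrib-+ (λ i → w i * b i) (λ i → w i * (a i - b i)) ⟩
  sum (λ i → w i * b i) + sum (λ i → w i * (a i - b i))
    ≈⟨ +-cong (≈-refl {sum (λ i → w i * b i)}) h ⟩
  sum (λ i → w i * b i) + 0ℝ
    ≈⟨ solve 1 (λ a → a :+ con 0ℚ := a) ≈-refl (sum (λ i → w i * b i)) ⟩
  sum (λ i → w i * b i) ∎
  where open ≈-Reasoning

sum-rescale : ∀ {k} σ (w a : Fin k → ℝ) →
  sum (λ i → w i * a i) ≈ 0ℝ → sum (λ i → w i * σ * a i) ≈ 0ℝ
sum-rescale σ w a h = begin
  sum (λ i → w i * σ * a i)
    ≈⟨ ℝ-Sum.sum-cong-≋ (λ i → solve 3 (λ w s a → w :* s :* a := s :* (w :* a))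
         ≈-refl (w i) σ (a i)) ⟩
  sum (λ i → σ * (w i * a i))    ≈⟨ ℝ-Product.*-distribˡ-sum σ (λ i → w i * a i) ⟨
  σ * sum (λ i → w i * a i)      ≈⟨ *-cong (≈-refl {σ}) h ⟩
  σ * 0ℝ                         ≈⟨ solve 1 (λ s → s :* con 0ℚ := con 0ℚ) ≈-refl σ ⟩
  0ℝ                             ∎
  where open ≈-Reasoning

-- If the differences p i - q i average to zero, then the p i and the q i have the same average,
-- which lies in both hulls.
convex-combinations-meet : ∀ {k m n} {g : Fin m → Point} {g′ : Fin n → Point}
  (w : Fin k → ℝ) (p q : Fin k → Point) →
  (∀ i → 0ℝ ≤ w i) → sum w ≈ 1ℝ → (∀ i → p i ∈ₚ hull g) → (∀ i → q i ∈ₚ hull g′) →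
  sum (λ i → w i * (x-coord (p i) - x-coord (q i))) ≈ 0ℝ →
  sum (λ i → w i * (y-coord (p i) - y-coord (q i))) ≈ 0ℝ →
  ∃[ c ] (c ∈ₚ hull g × c ∈ₚ hull g′)
convex-combinations-meet {k} {g = g} {g′} w p q 0≤w Σw p∈ q∈ Σx Σy = c
  , hull-closed {g = g} {p} {c} p∈ (w , 0≤w , Σw , ≈-refl {x-coord c} , ≈-refl {y-coord c})
  , hull-closed {g = g′} {q} {c} q∈ (w , 0≤w , Σw
      , sum-difference w (λ i → x-coord (p i)) (λ i → x-coord (q i)) Σx
      , sum-difference w (λ i → y-coord (p i)) (λ i → y-coord (q i)) Σy)
  where
  c : Point
  c = sum (λ i → w i * x-coord (p i)) ,ₚ sum (λ i → w i * y-coord (p i))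

-- Dividing by the total weight normalises the combination, so that cross products can serve as
-- weights later.
hulls-meet : ∀ {k m n} {g : Fin m → Point} {g′ : Fin n → Point}
  (w : Fin k → ℝ) (p q : Fin k → Point) →
  (∀ i → 0ℝ ≤ w i) → 0ℝ < sum w → (∀ i → p i ∈ₚ hull g) → (∀ i → q i ∈ₚ hull g′) →
  sum (λ i → w i * x-coord (p i -ₚ q i)) ≈ 0ℝ →
  sum (λ i → w i * y-coord (p i -ₚ q i)) ≈ 0ℝ →
  ∃[ c ] (c ∈ₚ hull g × c ∈ₚ hull g′)
hulls-meet {k} {g = g} {g′} w p q 0≤w 0<Σw p∈ q∈ Σx Σy =
  let (σ , 0≤σ , Σwσ) = inverse 0<Σw in
  convex-combinations-meet {g = g} {g′} (λ i → w i * σ) p q (λ i → 0≤-* (0≤w i) 0≤σ)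
    (≈-trans (≈-sym (ℝ-Product.*-distribʳ-sum σ w)) Σwσ) p∈ q∈
    (sum-rescale σ w (λ i → x-coord (p i -ₚ q i)) Σx)
    (sum-rescale σ w (λ i → y-coord (p i -ₚ q i)) Σy)

-- Sides of polygons

:dot : ∀ {n} (a b c d : Polynomial n) → Polynomial n
:dot a b c d = :cross b (:- a) c d

-- For v parallel to u the first summand vanishes, and `cross u` and `cross v` become proportional,
-- with the factors `dot u v` and `dot u u`.
dot-*-cross : ∀ u v w → dot u v * cross u w ≈ cross u v * dot u w + dot u u * cross v w
dot-*-cross (a ,ₚ b) (c ,ₚ d) (e ,ₚ f) = solve 6 (λ a b c d e f →
  :dot a b c d :* :cross a b e f :=
    :cross a b c d :* :dot a b e f :+ :dot a b a b :* :cross c d e f) ≈-refl a b c d e f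

-- Cramer's rule for w in terms of v and of u turned by a right angle; for w parallel to v only the
-- multiple of v remains.
dot-*-x : ∀ u v w → dot u v * x-coord w ≈ dot u w * x-coord v + cross v w * - y-coord u
dot-*-x (a ,ₚ b) (c ,ₚ d) (e ,ₚ f) = solve 6 (λ a b c d e f →
  :dot a b c d :* e := :dot a b e f :* c :+ :cross c d e f :* :- b) ≈-refl a b c d e f

dot-*-y : ∀ u v w → dot u v * y-coord w ≈ dot u w * y-coord v + cross v w * x-coord u
dot-*-y (a ,ₚ b) (c ,ₚ d) (e ,ₚ f) = solve 6 (λ a b c d e f →
  :dot a b c d :* f := :dot a b e f :* d :+ :cross c d e f :* a) ≈-refl a b c d e f

dot-pos : ∀ {u} → ¬ (u ≈ₚ origin) → Pos (dot u u)
dot-pos {a ,ₚ b} u≢0 h = u≢0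
  ( square≤0 (≤-trans (0≤-⇒≤ (0≤-resp (solve 2 (λ a b → b :* b := :dot a b a b :- a :* a)
      ≈-refl a b) (0≤-square b))) h)
  , square≤0 (≤-trans (0≤-⇒≤ (0≤-resp (solve 2 (λ a b → a :* a := :dot a b a b :- b :* b)
      ≈-refl a b) (0≤-square a))) h))

null-combination : ∀ {x y} p q → x ≈ 0ℝ → y ≈ 0ℝ → x * p + y * q ≈ 0ℝ
null-combination {x} {y} p q e f = ≈-trans (+-cong (*-cong e (≈-refl {p})) (*-cong f (≈-refl {q})))
  (solve 2 (λ p q → con 0ℚ :* p :+ con 0ℚ :* q := con 0ℚ) ≈-refl p q)

null-vector : ∀ {u d} → ¬ (u ≈ₚ origin) → cross u d ≈ 0ℝ → dot u d ≈ 0ℝ → d ≈ₚ origin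
null-vector {a ,ₚ b} {c ,ₚ d} u≢0 e f =
    ≈0-cancel (dot-pos u≢0) (≈-trans
      (solve 4 (λ a b c d → :dot a b a b :* c := :cross a b c d :* :- b :+ :dot a b c d :* a)
        ≈-refl a b c d) (null-combination (- b) a e f))
  , ≈0-cancel (dot-pos u≢0) (≈-trans
      (solve 4 (λ a b c d → :dot a b a b :* d := :cross a b c d :* a :+ :dot a b c d :* b)
        ≈-refl a b c d) (null-combination a b e f))

≈ₚ-from-difference : ∀ {p q} → q -ₚ p ≈ₚ origin → p ≈ₚ q
≈ₚ-from-difference {p} {q} (e , f) = diff e , diff f
  where
  diff : ∀ {x y} → y - x ≈ 0ℝ → x ≈ y
  diff {x} {y} e = ≈-trans (solve 1 (λ x → x := x :+ con 0ℚ) ≈-refl x)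
    (≈-trans (+-cong (≈-refl {x}) (≈-sym e))
      (solve 2 (λ x y → x :+ (y :- x) := y) ≈-refl x y))

-- As σ is 1 / s, this is c = a + (t / s)(b - a), in the exact shape of the sum in `hull` over two
-- points, final zero included.
interpolate : ∀ {s σ t} a b c → s * σ ≈ 1ℝ → s * (c - a) ≈ t * (b - a) →
  c ≈ (1ℝ - t * σ) * a + (t * σ * b + 0ℝ)
interpolate {s} {σ} {t} a b c sσ e = begin
  c
    ≈⟨ solve 2 (λ a c → c := con 1ℚ :* (c :- a) :+ a) ≈-refl a c ⟩
  1ℝ * (c - a) + a
    ≈⟨ +-cong (*-cong sσ (≈-refl {c - a})) (≈-refl {a}) ⟨
  s * σ * (c - a) + a
    ≈⟨ solve 4 (λ s σ a c → s :* σ :* (c :- a) :+ a := σ :* (s :* (c :- a)) :+ a) ≈-refl s σ a c ⟩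
  σ * (s * (c - a)) + a
    ≈⟨ +-cong (*-cong (≈-refl {σ}) e) (≈-refl {a}) ⟩
  σ * (t * (b - a)) + a
    ≈⟨ solve 4 (λ σ t a b → σ :* (t :* (b :- a)) :+ a :=
         (con 1ℚ :- t :* σ) :* a :+ (t :* σ :* b :+ con 0ℚ)) ≈-refl σ t a b ⟩
  (1ℝ - t * σ) * a + (t * σ * b + 0ℝ) ∎
  where open ≈-Reasoning

0≤±x⇒x≈0 : ∀ {x} → 0ℝ ≤ x → 0ℝ ≤ - x → x ≈ 0ℝ
0≤±x⇒x≈0 h k = ≤-antisym (neg-0≤ k) h

-- a and b are the two ends, along F, of the face of the hull on which cross F is minimal.
module Face {m : ℕ} (g : Fin m → Point) (F : Point) (F≢0 : ¬ (F ≈ₚ origin)) (a b : Point)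
  (a∈ : a ∈ₚ hull g) (b∈ : b ∈ₚ hull g)
  (a-first : ∀ i → a ⊑[ F , rot F ] g i) (b-last : ∀ i → b ⊑[ F , opposite (rot F) ] g i)
  where

  a⊑ : ∀ {c} → c ∈ₚ hull g → a ⊑[ F , rot F ] c
  a⊑ {c} = below-hull {g = g} {F} {rot F} {a} {c} a-first

  b⊑ : ∀ {c} → c ∈ₚ hull g → b ⊑[ F , opposite (rot F) ] c
  b⊑ {c} = below-hull {g = g} {F} {opposite (rot F)} {b} {c} b-last

  ends-level : cross F (b -ₚ a) ≈ 0ℝ
  ends-level = 0≤±x⇒x≈0 (proj₁ (a⊑ b∈))
    (0≤-resp (≈-sym (cross-swap F a b)) (proj₁ (b⊑ a∈)))

  -- Such a point lies level with both ends, so it takes part in the two tie-breaks, of which a wins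
  -- one and b the other.
  between : ∀ {c} → c ∈ₚ hull g → cross F (c -ₚ a) ≤ 0ℝ →
    0ℝ ≤ dot F (c -ₚ a) × 0ℝ ≤ dot F (b -ₚ c)
  between {c} c∈ h = proj₂ (a⊑ c∈) h
    , 0≤-resp (≈-sym (cross-opposite (rot F) c b))
        (proj₂ (b⊑ c∈) (≤-resp-≈ level ≈-refl h))
    where
    level : cross F (c -ₚ a) ≈ cross F (c -ₚ b)
    level = ≈-trans (≈-sym (cross-telescope F a b c)) (≈-trans
      (+-cong ends-level (≈-refl {cross F (c -ₚ b)}))
      (solve 1 (λ x → con 0ℚ :+ x := x) ≈-refl (cross F (c -ₚ b))))

  extent : ℝ
  extent = dot F (b -ₚ a)

  -- By `ends-level` F is parallel to b - a. Once the extent is positive, signs and zeros of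
  -- `cross F` thus carry over to `orient`, and back.
  extent-*-cross : ∀ w → extent * cross F w ≈ dot F F * cross (b -ₚ a) w
  extent-*-cross w = begin
    extent * cross F w                                          ≈⟨ dot-*-cross F (b -ₚ a) w ⟩
    cross F (b -ₚ a) * dot F w + dot F F * cross (b -ₚ a) w
      ≈⟨ +-cong (*-cong ends-level (≈-refl {dot F w})) (≈-refl {dot F F * cross (b -ₚ a) w}) ⟩
    0ℝ * dot F w + dot F F * cross (b -ₚ a) w
      ≈⟨ solve 2 (λ x y → con 0ℚ :* x :+ y := y) ≈-refl (dot F w) (dot F F * cross (b -ₚ a) w) ⟩
    dot F F * cross (b -ₚ a) w                                  ∎
    where open ≈-Reasoning

  module _ (extent>0 : Pos extent) where

    distinct-ends : ¬ (a ≈ₚ b)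
    distinct-ends (e , f) = extent>0 (≤-reflexive (≈-trans
      (+-cong (*-cong (≈-refl {y-coord F}) (+-cong (≈-refl {y-coord b}) (neg-cong f)))
        (neg-cong (*-cong (≈-refl { - x-coord F }) (+-cong (≈-refl {x-coord b}) (neg-cong e)))))
      (solve 4 (λ p q x y → :dot p q (x :- x) (y :- y) := con 0ℚ) ≈-refl
        (x-coord F) (y-coord F) (x-coord b) (y-coord b))))

    supporting : ∀ c → c ∈ₚ hull g → 0ℝ ≤ orient a b c
    supporting c c∈ = 0≤-cancel (dot-pos F≢0)
      (0≤-resp (extent-*-cross (c -ₚ a)) (0≤-* (Pos⇒0≤ extent>0) (proj₁ (a⊑ c∈))))

    on-segment : ∀ c → c ∈ₚ hull g → orient a b c ≈ 0ℝ → ∀ σ → 0ℝ ≤ σ → extent * σ ≈ 1ℝ →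
      c ∈ₚ segment a b
    -- The weight of b is the position t of c along F divided by the extent; by `between` it is
    -- nonnegative and at most one.
    on-segment c c∈ e σ 0≤σ lσ = weights , nonneg
      , solve 1 (λ x → (con 1ℚ :- x) :+ (x :+ con 0ℚ) := con 1ℚ) ≈-refl (t * σ)
      , interpolate {extent} {σ} {t} (x-coord a) (x-coord b) (x-coord c) lσ
          (collinear (- y-coord F) (dot-*-x F (b -ₚ a) (c -ₚ a)))
      , interpolate {extent} {σ} {t} (y-coord a) (y-coord b) (y-coord c) lσ
          (collinear (x-coord F) (dot-*-y F (b -ₚ a) (c -ₚ a)))
      where
      open ≈-Reasoning
      t : ℝ
      t = dot F (c -ₚ a)
      level : cross F (c -ₚ a) ≈ 0ℝ
      level = ≈0-cancel extent>0 (≈-trans (extent-*-cross (c -ₚ a))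
        (≈-trans (*-cong (≈-refl {dot F F}) e)
          (solve 1 (λ x → x :* con 0ℚ := con 0ℚ) ≈-refl (dot F F))))
      bounds : 0ℝ ≤ t × 0ℝ ≤ dot F (b -ₚ c)
      bounds = between c∈ (≤-reflexive level)
      weights : Fin 2 → ℝ
      weights = (1ℝ - t * σ) Vector.∷ (t * σ) Vector.∷ Vector.[]
      nonneg : ∀ i → 0ℝ ≤ weights i
      nonneg zero = 0≤-resp (begin
        dot F (b -ₚ c) * σ
          ≈⟨ solve 3 (λ x y σ → x :* σ := (y :+ x) :* σ :- y :* σ) ≈-refl (dot F (b -ₚ c)) t σ ⟩
        (t + dot F (b -ₚ c)) * σ - t * σ
          ≈⟨ +-cong (*-cong (cross-telescope (rot F) a c b) (≈-refl {σ})) (≈-refl { - (t * σ) }) ⟩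
        extent * σ - t * σ
          ≈⟨ +-cong lσ (≈-refl { - (t * σ) }) ⟩
        1ℝ - t * σ ∎) (0≤-* (proj₂ bounds) 0≤σ)
      nonneg (suc zero) = 0≤-* (proj₁ bounds) 0≤σ
      collinear : ∀ {x y} z → x ≈ y + orient a b c * z → x ≈ y
      collinear {x} {y} z h = ≈-trans h (≈-trans (+-cong (≈-refl {y}) (*-cong e (≈-refl {z})))
        (solve 2 (λ y z → y :+ con 0ℚ :* z := y) ≈-refl y z))

    segment⊆hull : ∀ c → c ∈ₚ segment a b → c ∈ₚ hull g
    segment⊆hull c = hull-closed {g = g} {a Vector.∷ b Vector.∷ Vector.[]} {c}
      λ { zero → a∈ ; (suc zero) → b∈ }

    segment-level : ∀ c → c ∈ₚ segment a b → orient a b c ≈ 0ℝ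
    segment-level c c∈ = ≈-trans
      (≈-sym (cross-hull {v = a Vector.∷ b Vector.∷ Vector.[]} {c} (b -ₚ a) a c∈))
      (solve 6 (λ p q r s u v →
          u :* :cross (r :- p) (s :- q) (p :- p) (q :- q) :+
            (v :* :cross (r :- p) (s :- q) (r :- p) (s :- q) :+ con 0ℚ) := con 0ℚ)
        ≈-refl (x-coord a) (y-coord a) (x-coord b) (y-coord b) (proj₁ c∈ zero) (proj₁ c∈ (suc zero)))

    side : 0ℝ < extent → IsSide (hull g) a b
    side 0<l = let (σ , 0≤σ , lσ) = inverse 0<l in
      distinct-ends , supporting , λ c → mk⇔
        (λ (c∈ , e) → on-segment c c∈ e σ 0≤σ lσ)
        (λ c∈ → segment⊆hull c c∈ , segment-level c c∈)

    parallel-to-side : ∀ {d} → Parallel (b -ₚ a) d → Parallel F d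
    parallel-to-side {d} e = ≈0-cancel extent>0 (≈-trans (extent-*-cross d)
      (≈-trans (*-cong (≈-refl {dot F F}) e)
        (solve 1 (λ x → x :* con 0ℚ := con 0ℚ) ≈-refl (dot F F))))

  -- If the extent were not positive, then the whole face would have a single position along F; c
  -- and d, which are level, would coincide.
  extent-pos : ∀ {c d} → c ∈ₚ hull g → d ∈ₚ hull g →
    cross F (c -ₚ a) ≤ 0ℝ → cross F (d -ₚ a) ≤ 0ℝ → ¬ (c ≈ₚ d) → Pos extent
  extent-pos {c} {d} c∈ d∈ hc hd c≢d l≤0 = c≢d (≈ₚ-from-difference
    (null-vector F≢0 level (0≤±x⇒x≈0 (along c∈ d∈ hc hd)
      (0≤-resp (≈-sym (cross-swap (rot F) c d)) (along d∈ c∈ hd hc)))))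
    where
    open ≈-Reasoning
    level : cross F (d -ₚ c) ≈ 0ℝ
    level = begin
      cross F (d -ₚ c)                          ≈⟨ cross-telescope F c a d ⟨
      cross F (a -ₚ c) + cross F (d -ₚ a)
        ≈⟨ +-cong (≈-trans (≈-sym (cross-swap F a c)) (neg-cong (≤-antisym hc (proj₁ (a⊑ c∈)))))
                  (≤-antisym hd (proj₁ (a⊑ d∈))) ⟩
      - 0ℝ + 0ℝ                                 ≈⟨ solve 0 (:- con 0ℚ :+ con 0ℚ := con 0ℚ) ≈-refl ⟩
      0ℝ                                        ∎
    along : ∀ {c d} → c ∈ₚ hull g → d ∈ₚ hull g →
      cross F (c -ₚ a) ≤ 0ℝ → cross F (d -ₚ a) ≤ 0ℝ → 0ℝ ≤ dot F (d -ₚ c)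
    along {c} {d} c∈ d∈ hc hd = 0≤-resp (begin
      - extent + (dot F (d -ₚ a) + dot F (b -ₚ c))
        ≈⟨ +-cong (neg-cong (≈-sym (cross-telescope (rot F) a c b))) (≈-refl {dot F (d -ₚ a) + dot F (b -ₚ c)}) ⟩
      - (dot F (c -ₚ a) + dot F (b -ₚ c)) + (dot F (d -ₚ a) + dot F (b -ₚ c))
        ≈⟨ solve 3 (λ x y z → :- (x :+ y) :+ (z :+ y) := :- x :+ z) ≈-refl
             (dot F (c -ₚ a)) (dot F (b -ₚ c)) (dot F (d -ₚ a)) ⟩
      - dot F (c -ₚ a) + dot F (d -ₚ a)
        ≈⟨ +-cong (cross-swap (rot F) a c) (≈-refl {dot F (d -ₚ a)}) ⟩
      dot F (a -ₚ c) + dot F (d -ₚ a)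
        ≈⟨ cross-telescope (rot F) c a d ⟩
      dot F (d -ₚ c) ∎) (0≤-+ (0≤-neg l≤0) (0≤-+ (proj₁ (between d∈ hd)) (proj₂ (between c∈ hc))))

-- Separation of disjoint polygons

-- By antisymmetry, equality amounts to two inequalities, which are negations.
≈-stable : ∀ {x y} → ¬ ¬ (x ≈ y) → x ≈ y
≈-stable h = ≤-antisym (h >>= ≤-reflexive) (h >>= λ e → ≤-reflexive (≈-sym e))

≈ₚ-stable : ∀ {p q} → ¬ ¬ (p ≈ₚ q) → p ≈ₚ q
≈ₚ-stable h = ≈-stable (λ k → h λ (e , _) → k e) , ≈-stable (λ k → h λ (_ , e) → k e)

Pos-cancel : ∀ {s x} → 0ℝ ≤ s → Pos (s * x) → Pos x
Pos-cancel {s} {x} 0≤s p x≤0 = p (neg-0≤ (0≤-resp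
  (solve 2 (λ s x → s :* :- x := :- (s :* x)) ≈-refl s x) (0≤-* 0≤s (0≤-neg x≤0))))

cross-cong : ∀ {u u′ v v′} → u ≈ₚ u′ → v ≈ₚ v′ → cross u v ≈ cross u′ v′
cross-cong (a , b) (c , d) = +-cong (*-cong a d) (neg-cong (*-cong b c))

-ₚ-cong : ∀ {p p′ q q′} → p ≈ₚ p′ → q ≈ₚ q′ → p -ₚ q ≈ₚ p′ -ₚ q′
-ₚ-cong (a , b) (c , d) = +-cong a (neg-cong c) , +-cong b (neg-cong d)

≈ₚ-refl : ∀ {p} → p ≈ₚ p
≈ₚ-refl = ≈-refl , ≈-refl

≈ₚ-sym : ∀ {p q} → p ≈ₚ q → q ≈ₚ p
≈ₚ-sym (a , b) = ≈-sym a , ≈-sym b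

⊑-resp : ∀ {u v p p′ q q′} → p ≈ₚ p′ → q ≈ₚ q′ → p ⊑[ u , v ] q → p′ ⊑[ u , v ] q′
⊑-resp e f = lex-resp (cross-cong ≈ₚ-refl (-ₚ-cong f e)) (cross-cong ≈ₚ-refl (-ₚ-cong f e))

-- Two distinct generators of minimal height make the face a nondegenerate side, whose ends are the
-- extremal generators in the two orders that break ties along F in opposite senses.
face-direction : ∀ {k} (L : Lines k) (P : Polygon) → P ∈𝒫 L → ∀ {F} → ¬ (F ≈ₚ origin) →
  ∀ i j → let g = Polygon.generators P in
  (∀ l → 0ℝ ≤ cross F (g l -ₚ g i)) → (∀ l → 0ℝ ≤ cross F (g l -ₚ g j)) → ¬ (g i ≈ₚ g j) →
  ¬ ¬ (∃[ l ] Parallel F (direction L l))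
face-direction L P P∈ {F} F≢0 i j i-min j-min i≢j k =
  minimum (allFin _) ∈-allFin zero g F (rot F) λ (ia , a-first) →
  minimum (allFin _) ∈-allFin zero g F (opposite (rot F)) λ (ib , b-last) →
  let open Face g F F≢0 (g ia) (g ib) (generator∈hull g ia) (generator∈hull g ib) a-first b-last
      below : ∀ c → 0ℝ ≤ cross F (g ia -ₚ c) → cross F (c -ₚ g ia) ≤ 0ℝ
      below c h = neg-0≤ (0≤-resp (≈-sym (cross-swap F (g ia) c)) h)
      l>0 = extent-pos (generator∈hull g i) (generator∈hull g j)
        (below (g i) (i-min ia)) (below (g j) (j-min ia)) i≢j
  in l>0 λ 0<l → let (l , e) = P∈ (g ia) (g ib) (side l>0 0<l) in k (l , parallel-to-side l>0 {direction L l} e)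
  where
  g : Fin (ℕ.suc (Polygon.size-1 P)) → Point
  g = Polygon.generators P

-- Strictly after and strictly before the origin in the order of F, each as the failure of the
-- reverse comparison.
Above Below : Point → Point → Set
Above F p = ¬ (p ⊑[ F , rot F ] origin)
Below F p = ¬ (origin ⊑[ F , rot F ] p)

-- G is the multiple of F by `dot F G / dot F F`, which is not zero as G is not; its sign decides
-- whether the order is kept or reversed.
parallel-sides : ∀ {F G} → ¬ (F ≈ₚ origin) → ¬ (G ≈ₚ origin) → Parallel F G →
  ¬ ¬ ((∀ {p} → Above F p → Above G p) ⊎ (∀ {p} → Above F p → Below G p))
parallel-sides {F} {G} F≢0 G≢0 e k = ≤-total c 0ℝ λ
  { (inj₂ 0<c) → k (inj₁ λ {p} h d → h (lex-cancel (<⇒Pos 0<c)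
      (lex-resp (scale-cross (origin -ₚ p)) (scale-dot (origin -ₚ p)) (lex-* f≥0 d))))
  ; (inj₁ c≤0) → ≤-total (- c) 0ℝ λ
    { (inj₁ -c≤0) → G≢0 (null-vector F≢0 e (0≤±x⇒x≈0 (neg-0≤-neg -c≤0) (0≤-neg c≤0)))
    ; (inj₂ 0<-c) → k (inj₂ λ {p} h d → h (lex-cancel (<⇒Pos 0<-c)
        (lex-resp (flip F p (scale-cross (p -ₚ origin)))
                  (flip (rot F) p (scale-dot (p -ₚ origin))) (lex-* f≥0 d)))) } }
  where
  open ≈-Reasoning
  c f : ℝ
  c = dot F G
  f = dot F F
  f≥0 : 0ℝ ≤ f
  f≥0 = Pos⇒0≤ (dot-pos F≢0)
  neg-0≤-neg : ∀ {x} → - x ≤ 0ℝ → 0ℝ ≤ x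
  neg-0≤-neg {x} h = 0≤-resp (solve 1 (λ x → :- :- x := x) ≈-refl x) (0≤-neg h)
  vanish : ∀ x y → cross F G * x + y ≈ y
  vanish x y = ≈-trans (+-cong (*-cong e (≈-refl {x})) (≈-refl {y}))
    (solve 2 (λ x y → con 0ℚ :* x :+ y := y) ≈-refl x y)
  scale-cross : ∀ w → f * cross G w ≈ c * cross F w
  scale-cross w = ≈-sym (≈-trans (dot-*-cross F G w) (vanish (dot F w) (f * cross G w)))
  scale-dot : ∀ w → f * dot G w ≈ c * dot F w
  scale-dot w = ≈-trans (dot-*-dot F G w) (vanish (cross F w) (c * dot F w))
    where
    dot-*-dot : ∀ u v w → dot u u * dot v w ≈ cross u v * cross u w + dot u v * dot u w
    dot-*-dot (a ,ₚ b) (c ,ₚ d) (e ,ₚ f) = solve 6 (λ a b c d e f →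
      :dot a b a b :* :dot c d e f :=
        :cross a b c d :* :cross a b e f :+ :dot a b c d :* :dot a b e f) ≈-refl a b c d e f
  flip : ∀ u p {x} → x ≈ c * cross u (p -ₚ origin) → x ≈ - c * cross u (origin -ₚ p)
  flip u p {x} h = begin
    x                                     ≈⟨ h ⟩
    c * cross u (p -ₚ origin)
      ≈⟨ *-cong (≈-refl {c}) (cross-swap u p origin) ⟨
    c * - cross u (origin -ₚ p)
      ≈⟨ solve 2 (λ c x → c :* :- x := :- c :* x) ≈-refl c (cross u (origin -ₚ p)) ⟩
    - c * cross u (origin -ₚ p)           ∎

-- A line through two distinct points d x that supports all of them and is visible from the origin.
-- The vector `normal` points along this line, since heights are measured by `cross`. The origin may
-- lie on the line if the points on it all lie ahead.
record Facet {A : Set} (d : A → Point) : Set where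
  field
    normal        : Point
    normal≢0      : ¬ (normal ≈ₚ origin)
    from to       : A
    from≢to       : ¬ (d from ≈ₚ d to)
    from-minimal  : ∀ x → 0ℝ ≤ cross normal (d x -ₚ d from)
    to-minimal    : ∀ x → 0ℝ ≤ cross normal (d x -ₚ d to)
    above         : ∀ x → Above normal (d x)

-- Up to the normalisation of w, the origin lies outside the hull of the points d x.
Pointed : {A : Set} → (A → Point) → Set
Pointed {A} d = ∀ {m} (w : Fin m → ℝ) (a : Fin m → A) → (∀ i → 0ℝ ≤ w i) → Pos (sum w) →
  sum (λ i → w i * x-coord (d (a i))) ≈ 0ℝ → ¬ sum (λ i → w i * y-coord (d (a i))) ≈ 0ℝ

-- Angular comparison and visible facets

cross-antisym : ∀ u v → - cross u v ≈ cross v u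
cross-antisym (a ,ₚ b) (c ,ₚ d) = solve 4 (λ a b c d →
  :- :cross a b c d := :cross c d a b) ≈-refl a b c d

cross-origin : ∀ u p → cross u (origin -ₚ p) ≈ - cross u p
cross-origin (a ,ₚ b) (c ,ₚ d) = solve 4 (λ a b c d →
  :cross a b (con 0ℚ :- c) (con 0ℚ :- d) := :- :cross a b c d) ≈-refl a b c d

cross-total : ∀ u v → ¬ ¬ (0ℝ ≤ cross u v ⊎ 0ℝ ≤ cross v u)
cross-total u v k = ≤-total 0ℝ (cross u v) λ
  { (inj₁ h) → k (inj₁ h)
  ; (inj₂ h) → k (inj₂ (0≤-resp (cross-antisym u v) (0≤-neg (<-asym h)))) }

-- The three-term Plücker relation. For a, b and c strictly to the left of e it makes the comparison
-- of their angles transitive.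
plücker : ∀ e a b c → cross e b * cross c a ≈ cross e a * cross c b + cross e c * cross b a
plücker (e ,ₚ f) (a ,ₚ b) (c ,ₚ d) (g ,ₚ h) = solve 8 (λ e f a b c d g h →
  :cross e f c d :* :cross g h a b :=
    :cross e f a b :* :cross g h c d :+ :cross e f g h :* :cross c d a b) ≈-refl e f a b c d g h

-- The cross products of pairs of points are the unnormalised barycentric coordinates of the origin
-- in their triangle.
cross-cyclic-x : ∀ a b c →
  cross b c * x-coord a + (cross c a * x-coord b + (cross a b * x-coord c + 0ℝ)) ≈ 0ℝ
cross-cyclic-x (a ,ₚ b) (c ,ₚ d) (e ,ₚ f) = solve 6 (λ a b c d e f →
  :cross c d e f :* a :+ (:cross e f a b :* c :+ (:cross a b c d :* e :+ con 0ℚ)) := con 0ℚ)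
  ≈-refl a b c d e f

cross-cyclic-y : ∀ a b c →
  cross b c * y-coord a + (cross c a * y-coord b + (cross a b * y-coord c + 0ℝ)) ≈ 0ℝ
cross-cyclic-y (a ,ₚ b) (c ,ₚ d) (e ,ₚ f) = solve 6 (λ a b c d e f →
  :cross c d e f :* b :+ (:cross e f a b :* d :+ (:cross a b c d :* f :+ con 0ℚ)) := con 0ℚ)
  ≈-refl a b c d e f

module Angular {A : Set} (xs : List A) (complete : ∀ x → x ∈ₗ xs) (a₀ : A)
  (d : A → Point) (pointed : Pointed d) where

  nonzero-point : ∀ x → ¬ (d x ≈ₚ origin)
  nonzero-point x (e , f) = pointed {1} (λ _ → 1ℝ) (λ _ → x) (λ _ → 0≤1)
    (λ h → <⇒Pos 0<1 (≤-resp-≈ (solve 0 (con 1ℚ :+ con 0ℚ := con 1ℚ) ≈-refl) ≈-refl h))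
    (single e) (single f)
    where
    0<1 : 0ℝ < 1ℝ
    0<1 = mk< 1ℚ (ℚ.positive⁻¹ 1ℚ) (always λ _ → ℚ.≤-refl)
    single : ∀ {x} → x ≈ 0ℝ → 1ℝ * x + 0ℝ ≈ 0ℝ
    single {x} e = ≈-trans (solve 1 (λ x → con 1ℚ :* x :+ con 0ℚ := x) ≈-refl x) e

  -- If transitivity failed, then the origin would lie in the triangle of x, y and z.
  turn-trans : ∀ {x y z} → 0ℝ ≤ cross (d x) (d y) → 0ℝ ≤ cross (d y) (d z) →
    0ℝ ≤ cross (d x) (d z)
  turn-trans {x} {y} {z} h k = λ xz<0 →
    let zx≥0 : 0ℝ ≤ cross (d z) (d x)
        zx≥0 = 0≤-resp (cross-antisym (d x) (d z)) (0≤-neg (<-asym xz<0))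
        zx>0 : Pos (cross (d z) (d x))
        zx>0 = λ zx≤0 → zx≤0 (<-resp-≈ ≈-refl (≈-trans
          (solve 1 (λ a → con 0ℚ :- a := :- a) ≈-refl (cross (d x) (d z)))
          (cross-antisym (d x) (d z))) (<⇒0<- xz<0))
    in pointed (cross (d y) (d z) Vector.∷ cross (d z) (d x) Vector.∷ cross (d x) (d y) Vector.∷ Vector.[])
      (x Vector.∷ y Vector.∷ z Vector.∷ Vector.[])
      (λ { zero → k ; (suc zero) → zx≥0 ; (suc (suc zero)) → h })
      (Pos-+ k (Pos-resp (solve 2 (λ a b → b :+ a := a :+ (b :+ con 0ℚ)) ≈-refl
         (cross (d z) (d x)) (cross (d x) (d y))) (Pos-+ h zx>0)))
      (cross-cyclic-x (d x) (d y) (d z)) (cross-cyclic-y (d x) (d y) (d z))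

  -- Seen from the origin, the points fill an angle of less than a half-turn, where the turning
  -- order has a clockwise end.
  tangent : ¬ ¬ (∃[ r ] (∀ x → 0ℝ ≤ cross (d r) (d x)))
  tangent k = select {G = λ _ → ⊤} (λ x y → 0ℝ ≤ cross (d x) (d y))
    (λ x y → cross-total (d x) (d y)) (λ {x} {y} {z} _ _ _ → turn-trans {x} {y} {z})
    xs a₀ tt λ (r , _ , _ , h) → k (r , λ x → h x (complete x) tt)

  -- Otherwise the two collinear points would have the origin between them, as their combination
  -- with the weights `dot (d x) (d x)` and `- dot (d r) (d x)`.
  same-ray : ∀ r x → cross (d r) (d x) ≈ 0ℝ → Pos (dot (d r) (d x))
  same-ray r x e h = pointed
    (dot (d x) (d x) Vector.∷ (- dot (d r) (d x)) Vector.∷ Vector.[])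
    (r Vector.∷ x Vector.∷ Vector.[])
    (λ { zero → Pos⇒0≤ xx>0 ; (suc zero) → 0≤-neg h })
    (Pos-resp (solve 2 (λ a b → b :+ a := a :+ (b :+ con 0ℚ)) ≈-refl
      (dot (d x) (d x)) (- dot (d r) (d x))) (Pos-+ (0≤-neg h) xx>0))
    (≈-trans (identity-x (d r) (d x)) (vanish (y-coord (d x))))
    (≈-trans (identity-y (d r) (d x)) (vanish (- x-coord (d x))))
    where
    xx>0 : Pos (dot (d x) (d x))
    xx>0 = dot-pos (nonzero-point x)
    identity-x : ∀ r x → dot x x * x-coord r + (- dot r x * x-coord x + 0ℝ) ≈ cross r x * y-coord x
    identity-x (a ,ₚ b) (c ,ₚ d) = solve 4 (λ a b c d →
      :dot c d c d :* a :+ (:- :dot a b c d :* c :+ con 0ℚ) := :cross a b c d :* d) ≈-refl a b c d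
    identity-y : ∀ r x → dot x x * y-coord r + (- dot r x * y-coord x + 0ℝ) ≈ cross r x * - x-coord x
    identity-y (a ,ₚ b) (c ,ₚ d) = solve 4 (λ a b c d →
      :dot c d c d :* b :+ (:- :dot a b c d :* d :+ con 0ℚ) := :cross a b c d :* :- c) ≈-refl a b c d
    vanish : ∀ z → cross (d r) (d x) * z ≈ 0ℝ
    vanish z = ≈-trans (*-cong e (≈-refl {z})) (solve 1 (λ z → con 0ℚ :* z := con 0ℚ) ≈-refl z)

  module Visible (r₀ : A) (r₀-tangent : ∀ x → 0ℝ ≤ cross (d r₀) (d x))
    (r : A) (r-first : ∀ x → d r ⊑[ d r₀ , rot (d r₀) ] d x) where

    e : Point
    e = d r₀

    v : A → Point
    v x = d x -ₚ d r

    -- Minimality puts d r no higher than d r₀, whose height is zero, and tangency no lower.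
    r-level : cross e (d r) ≈ 0ℝ
    r-level = ≤-antisym (neg-0≤ (0≤-resp (difference e (d r)) (proj₁ (r-first r₀)))) (r₀-tangent r)
      where
      difference : ∀ u p → cross u (u -ₚ p) ≈ - cross u p
      difference (a ,ₚ b) (c ,ₚ d) = solve 4 (λ a b c d →
        :cross a b (a :- c) (b :- d) := :- :cross a b c d) ≈-refl a b c d

    v-level : ∀ x → cross e (v x) ≈ cross e (d x)
    v-level x = begin
      cross e (v x)                      ≈⟨ split e (d x) (d r) ⟩
      cross e (d x) - cross e (d r)      ≈⟨ +-cong (≈-refl {cross e (d x)}) (neg-cong r-level) ⟩
      cross e (d x) - 0ℝ                 ≈⟨ solve 1 (λ a → a :- con 0ℚ := a) ≈-refl (cross e (d x)) ⟩
      cross e (d x)                      ∎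
      where
      open ≈-Reasoning
      split : ∀ u p q → cross u (p -ₚ q) ≈ cross u p - cross u q
      split (a ,ₚ b) (c ,ₚ d) (e ,ₚ f) = solve 6 (λ a b c d e f →
        :cross a b (c :- e) (d :- f) := :cross a b c d :- :cross a b e f) ≈-refl a b c d e f

    e≢0 : ¬ (e ≈ₚ origin)
    e≢0 = nonzero-point r₀

    -- All points lie on a line through the origin, so only the tie-break can tell them from the
    -- origin; `same-ray` supplies it.
    facet-on-ray : (∀ x → cross e (d x) ≤ 0ℝ) → ∀ s → ¬ (d r ≈ₚ d s) → Facet d
    facet-on-ray h s r≢s = record
      { normal = e ; normal≢0 = e≢0 ; from = r ; to = s ; from≢to = r≢s
      ; from-minimal = λ x → ≤-reflexive (≈-sym (≈-trans (v-level x) (level x)))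
      ; to-minimal = λ x → ≤-reflexive (≈-sym (≈-trans (≈-sym (cross-telescope e (d s) (d r) (d x)))
          (≈-trans (+-cong (≈-trans (≈-sym (cross-swap e (d r) (d s)))
                             (neg-cong (≈-trans (v-level s) (level s))))
                           (≈-trans (v-level x) (level x)))
            (solve 0 (:- con 0ℚ :+ con 0ℚ := con 0ℚ) ≈-refl))))
      ; above = λ x (_ , p) → same-ray r₀ x (level x) (neg-0≤ (0≤-resp (cross-origin (rot e) (d x))
          (p (≤-reflexive (≈-trans (cross-origin e (d x))
            (≈-trans (neg-cong (level x)) (solve 0 (:- con 0ℚ := con 0ℚ) ≈-refl))))))) }
      where
      level : ∀ x → cross e (d x) ≈ 0ℝ
      level x = ≤-antisym (h x) (r₀-tangent x)

    -- Off the extreme ray the angles at d r are comparable by `plücker`. For y on the ray, `v y` is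
    -- a nonnegative multiple of e, so it lies to the right of every candidate.
    leftmost : ∀ {x} → Pos (cross e (d x)) →
      ¬ ¬ (∃[ s ] (Pos (cross e (d s)) × (∀ y → 0ℝ ≤ cross (v y) (v s))))
    leftmost {x} x-off k = select {G = λ x → Pos (cross e (d x))} (λ x y → 0ℝ ≤ cross (v y) (v x))
      (λ x y → cross-total (v y) (v x))
      (λ {a} {b} {c} ga gb gc h h′ → 0≤-cancel (off gb) (0≤-resp (≈-sym (plücker e (v a) (v b) (v c)))
        (0≤-+ (0≤-* (Pos⇒0≤ (off ga)) h′) (0≤-* (Pos⇒0≤ (off gc)) h))))
      xs x x-off λ (s , s-off , _ , h) → k (s , s-off , λ y → ≤-total (cross e (d y)) 0ℝ >>= λ
        { (inj₂ 0<y) → h y (complete y) (<⇒Pos 0<y)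
        ; (inj₁ y≤0) → on-ray s-off y≤0 })
      where
      off : ∀ {x} → Pos (cross e (d x)) → Pos (cross e (v x))
      off {x} = Pos-resp (≈-sym (v-level x))
      on-ray : ∀ {s y} → Pos (cross e (d s)) → cross e (d y) ≤ 0ℝ → 0ℝ ≤ cross (v y) (v s)
      on-ray {s} {y} s-off y≤0 = 0≤-cancel (dot-pos e≢0) (0≤-resp (begin
        dot e (v y) * cross e (v s)
          ≈⟨ dot-*-cross e (v y) (v s) ⟩
        cross e (v y) * dot e (v s) + dot e e * cross (v y) (v s)
          ≈⟨ +-cong (*-cong y-level (≈-refl {dot e (v s)})) (≈-refl {dot e e * cross (v y) (v s)}) ⟩
        0ℝ * dot e (v s) + dot e e * cross (v y) (v s)
          ≈⟨ solve 2 (λ a b → con 0ℚ :* a :+ b := b) ≈-refl (dot e (v s)) (dot e e * cross (v y) (v s)) ⟩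
        dot e e * cross (v y) (v s) ∎)
        (0≤-* (proj₂ (r-first y) (≤-reflexive y-level)) (Pos⇒0≤ (off s-off))))
        where
        open ≈-Reasoning
        y-level : cross e (v y) ≈ 0ℝ
        y-level = ≈-trans (v-level y) (≤-antisym y≤0 (r₀-tangent y))

    -- Here d r is the point nearest to the origin on the extreme ray through d r₀, and d s is, as
    -- seen from d r, the extreme point towards the origin: the line through them separates the
    -- origin from all points.
    facet-at-corner : ∀ s → Pos (cross e (d s)) → (∀ y → 0ℝ ≤ cross (v y) (v s)) → Facet d
    facet-at-corner s s-off s-left = record
      { normal = F
      ; normal≢0 = λ F≈0 → r≢s (≈ₚ-sym (≈ₚ-from-difference F≈0))
      ; from = r ; to = s ; from≢to = r≢s
      ; from-minimal = from-minimal
      ; to-minimal = λ x → 0≤-resp (cross-telescope F (d s) (d r) (d x))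
          (0≤-+ (≤-reflexive (≈-sym (cross-self F))) (from-minimal x))
      ; above = λ x (h , _) → Pos-resp (sum-level x)
          (Pos-+ (from-minimal x) r-off)
          (neg-0≤ (0≤-resp (cross-origin F (d x)) h)) }
      where
      open ≈-Reasoning
      F : Point
      F = d r -ₚ d s
      cross-self : ∀ u → cross u u ≈ 0ℝ
      cross-self (a ,ₚ b) = solve 2 (λ a b → :cross a b a b := con 0ℚ) ≈-refl a b
      reverse : ∀ p q w → cross w (q -ₚ p) ≈ cross (p -ₚ q) w
      reverse (a ,ₚ b) (c ,ₚ d) (e ,ₚ f) = solve 6 (λ a b c d e f →
        :cross e f (c :- a) (d :- b) := :cross (a :- c) (b :- d) e f) ≈-refl a b c d e f
      r≢s : ¬ (d r ≈ₚ d s)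
      r≢s eq = s-off (≤-reflexive (≈-trans (cross-cong (≈ₚ-refl {e}) (≈ₚ-sym eq)) r-level))
      from-minimal : ∀ x → 0ℝ ≤ cross F (v x)
      from-minimal x = 0≤-resp (reverse (d r) (d s) (v x)) (s-left x)
      r-off : Pos (cross F (d r))
      r-off = Pos-resp (reverse (d r) (d s) (d r)) (Pos-cancel (Pos⇒0≤ (dot-pos e≢0)) (Pos-resp (begin
        dot e (d r) * cross e (v s)
          ≈⟨ dot-*-cross e (d r) (v s) ⟩
        cross e (d r) * dot e (v s) + dot e e * cross (d r) (v s)
          ≈⟨ +-cong (*-cong r-level (≈-refl {dot e (v s)})) (≈-refl {dot e e * cross (d r) (v s)}) ⟩
        0ℝ * dot e (v s) + dot e e * cross (d r) (v s)
          ≈⟨ solve 2 (λ a b → con 0ℚ :* a :+ b := b) ≈-refl (dot e (v s)) (dot e e * cross (d r) (v s)) ⟩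
        dot e e * cross (d r) (v s) ∎)
        (Pos-* (same-ray r₀ r r-level) (Pos-resp (≈-sym (v-level s)) s-off))))
      sum-level : ∀ x → cross F (v x) + cross F (d r) ≈ cross F (d x)
      sum-level x = split F (d x) (d r)
        where
        split : ∀ u p q → cross u (p -ₚ q) + cross u q ≈ cross u p
        split (a ,ₚ b) (c ,ₚ d) (e ,ₚ f) = solve 6 (λ a b c d e f →
          :cross a b (c :- e) (d :- f) :+ :cross a b e f := :cross a b c d) ≈-refl a b c d e f

  -- A point off the extreme ray yields a corner, and two distinct points on the ray a facet along
  -- it. Otherwise all points coincide and there is no facet.
  facet : ¬ ¬ (Facet d ⊎ ∃[ r ] (∀ x → d r ≈ₚ d x))
  facet k = tangent λ (r₀ , r₀-tangent) →
    minimum xs complete a₀ d (d r₀) (rot (d r₀)) λ (r , r-first) →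
    let open Visible r₀ r₀-tangent r r-first in
    ¬¬-excluded-middle {A = ∃[ x ] Pos (cross (d r₀) (d x))} λ
      { (yes (x , x-off)) → leftmost x-off λ (s , s-off , s-left) →
          k (inj₁ (facet-at-corner s s-off s-left))
      ; (no none) → ¬¬-excluded-middle {A = ∃[ s ] ¬ (d r ≈ₚ d s)} λ
        { (yes (s , r≢s)) → k (inj₁ (facet-on-ray
            (λ x 0<x → none (x , <⇒Pos 0<x)) s r≢s))
        ; (no all) → k (inj₂ (r , λ x → ≈ₚ-stable λ r≢x → all (x , r≢x))) } }

-- The failure of the reverse comparison expresses strict precedence: of Q in the first alternative,
-- of P in the second.
Separated : Polygon → Polygon → Point → Set
Separated P Q G =
  (∀ i j → ¬ (Polygon.generators P i ⊑[ G , rot G ] Polygon.generators Q j)) ⊎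
  (∀ i j → ¬ (Polygon.generators Q j ⊑[ G , rot G ] Polygon.generators P i))

disjoint⇒separated : ∀ {k} (L : Lines k) → Fin k → ∀ P Q → P ∈𝒫 L → Q ∈𝒫 L → ¬ Intersecting P Q →
  ¬ ¬ (∃[ l ] Separated P Q (direction L l))
disjoint⇒separated L l₀ P Q P∈ Q∈ disjoint k = facet λ
  { (inj₁ φ) → from-facet φ
  -- All differences equal one nonzero vector, so every direction separates, and the given l₀ will
  -- do.
  ; (inj₂ (r , same)) → let G = direction L l₀ in
      ⊑-total G (rot G) (d r) origin λ
      { (inj₁ below) → k (l₀ , inj₂ λ i j h → irreflexive-at r (nonzero L l₀) below
          (⊑-resp {G} {rot G} ≈ₚ-refl (≈ₚ-sym (same (i , j))) (above-difference G i j h)))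
      ; (inj₂ above) → k (l₀ , inj₁ λ i j h → irreflexive-at r (nonzero L l₀)
          (⊑-resp {G} {rot G} (≈ₚ-sym (same (i , j))) ≈ₚ-refl (below-difference G i j h)) above) } }
  where
  open Polygon P using () renaming (generators to p; size-1 to m)
  open Polygon Q using () renaming (generators to q; size-1 to n)
  A : Set
  A = Fin (ℕ.suc m) × Fin (ℕ.suc n)
  d : A → Point
  d (i , j) = p i -ₚ q j
  -- Disjointness enters here: a vanishing combination of differences would give a common point.
  pointed : Pointed d
  pointed w a 0≤w Σw>0 Σx Σy = Σw>0 λ 0<Σw → disjoint (hulls-meet {g = p} {q} w
    (λ i → p (proj₁ (a i))) (λ i → q (proj₂ (a i))) 0≤w 0<Σw
    (λ i → generator∈hull p (proj₁ (a i))) (λ i → generator∈hull q (proj₂ (a i))) Σx Σy)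
  open Angular (cartesianProduct (allFin (ℕ.suc m)) (allFin (ℕ.suc n)))
    (λ (i , j) → ∈-cartesianProduct⁺ (∈-allFin i) (∈-allFin j)) (zero , zero) d pointed
  swap : ∀ u a b → cross u (b -ₚ a) ≈ cross u (origin -ₚ (a -ₚ b))
  swap (a ,ₚ b) (c ,ₚ d) (e ,ₚ f) = solve 6 (λ a b c d e f →
    :cross a b (e :- c) (f :- d) := :cross a b (con 0ℚ :- (c :- e)) (con 0ℚ :- (d :- f)))
    ≈-refl a b c d e f
  keep : ∀ u a b → cross u (a -ₚ b) ≈ cross u ((a -ₚ b) -ₚ origin)
  keep (a ,ₚ b) (c ,ₚ d) (e ,ₚ f) = solve 6 (λ a b c d e f →
    :cross a b (c :- e) (d :- f) := :cross a b ((c :- e) :- con 0ℚ) ((d :- f) :- con 0ℚ))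
    ≈-refl a b c d e f
  below-difference : ∀ G i j → p i ⊑[ G , rot G ] q j → d (i , j) ⊑[ G , rot G ] origin
  below-difference G i j = lex-resp (swap G (p i) (q j)) (swap (rot G) (p i) (q j))
  above-difference : ∀ G i j → q j ⊑[ G , rot G ] p i → origin ⊑[ G , rot G ] d (i , j)
  above-difference G i j = lex-resp (keep G (p i) (q j)) (keep (rot G) (p i) (q j))
  ⊑-antisym : ∀ {G x y} → ¬ (G ≈ₚ origin) → x ⊑[ G , rot G ] y → y ⊑[ G , rot G ] x → x ≈ₚ y
  ⊑-antisym {G} {x} {y} G≢0 (h , h′) (k , k′) = ≈ₚ-from-difference (null-vector G≢0
    (0≤±x⇒x≈0 h (0≤-resp (≈-sym (cross-swap G x y)) k))
    (0≤±x⇒x≈0 (h′ (neg-0≤ (0≤-resp (≈-sym (cross-swap G x y)) k)))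
      (0≤-resp (≈-sym (cross-swap (rot G) x y))
        (k′ (neg-0≤ (0≤-resp (≈-sym (cross-swap G y x)) h))))))
  irreflexive-at : ∀ x {G} → ¬ (G ≈ₚ origin) → d x ⊑[ G , rot G ] origin → ¬ origin ⊑[ G , rot G ] d x
  irreflexive-at x G≢0 h k = nonzero-point x (⊑-antisym G≢0 h k)
  -- The two points of the facet differ in their P-component or in their Q-component.
  from-facet : Facet d → ⊥
  from-facet φ = ¬¬-excluded-middle {A = p i₁ ≈ₚ p i₂} λ
      { (no p≢) → face-direction L P P∈ normal≢0 i₁ i₂
          (λ i → 0≤-resp (cancel-q normal (p i) (p i₁) (q j₁)) (from-minimal (i , j₁)))
          (λ i → 0≤-resp (cancel-q normal (p i) (p i₂) (q j₂)) (to-minimal (i , j₂)))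
          p≢ finish
      ; (yes p≈) → face-direction L Q Q∈ opposite≢0 j₁ j₂
          (λ j → 0≤-resp (cancel-p normal (q j) (q j₁) (p i₁)) (from-minimal (i₁ , j)))
          (λ j → 0≤-resp (cancel-p normal (q j) (q j₂) (p i₂)) (to-minimal (i₂ , j)))
          (λ q≈ → from≢to (-ₚ-cong p≈ q≈))
          λ (l , e) → finish (l , parallel-opposite e) }
    where
    open Facet φ
    i₁ = proj₁ from
    j₁ = proj₂ from
    i₂ = proj₁ to
    j₂ = proj₂ to
    cancel-q : ∀ u a b c → cross u ((a -ₚ c) -ₚ (b -ₚ c)) ≈ cross u (a -ₚ b)
    cancel-q (a ,ₚ b) (c ,ₚ d) (e ,ₚ f) (g ,ₚ h) = solve 8 (λ a b c d e f g h →
      :cross a b ((c :- g) :- (e :- g)) ((d :- h) :- (f :- h)) := :cross a b (c :- e) (d :- f))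
      ≈-refl a b c d e f g h
    -- Q enters the difference with a minus sign, so its face is minimal for the opposite vector.
    cancel-p : ∀ u a b c → cross u ((c -ₚ a) -ₚ (c -ₚ b)) ≈ cross (opposite u) (a -ₚ b)
    cancel-p (a ,ₚ b) (c ,ₚ d) (e ,ₚ f) (g ,ₚ h) = solve 8 (λ a b c d e f g h →
      :cross a b ((g :- c) :- (g :- e)) ((h :- d) :- (h :- f)) := :cross (:- a) (:- b) (c :- e) (d :- f))
      ≈-refl a b c d e f g h
    neg-null : ∀ {x} → - x ≈ 0ℝ → x ≈ 0ℝ
    neg-null {x} e = ≈-trans (solve 1 (λ x → x := :- :- x) ≈-refl x)
      (≈-trans (neg-cong e) (solve 0 (:- con 0ℚ := con 0ℚ) ≈-refl))
    opposite≢0 : ¬ (opposite normal ≈ₚ origin)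
    opposite≢0 (e , f) = normal≢0 (neg-null e , neg-null f)
    parallel-opposite : ∀ {G} → Parallel (opposite normal) G → Parallel normal G
    parallel-opposite {G} e = neg-null (≈-trans (cross-neg normal G) e)
      where
      cross-neg : ∀ u w → - cross u w ≈ cross (opposite u) w
      cross-neg (a ,ₚ b) (c ,ₚ d) = solve 4 (λ a b c d →
        :- :cross a b c d := :cross (:- a) (:- b) c d) ≈-refl a b c d
    -- The facet separates in the order of `normal`; `parallel-sides` transfers this to the line of
    -- L, possibly exchanging the roles of P and Q.
    finish : ¬ (∃[ l ] Parallel normal (direction L l))
    finish (l , e) = let G = direction L l in parallel-sides {normal} {G} normal≢0 (nonzero L l) e λ
      { (inj₁ t) → k (l , inj₁ λ i j h → t {d (i , j)} (above (i , j)) (below-difference G i j h))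
      ; (inj₂ t) → k (l , inj₂ λ i j h → t {d (i , j)} (above (i , j)) (above-difference G i j h)) }

-- Counting maximal cliques

-- Finitely many classical choices can be made at once.
¬¬-Π : ∀ {n} {B : Fin n → Set} → (∀ i → ¬ ¬ B i) → ¬ ¬ (∀ i → B i)
¬¬-Π = Fin.sequence (RawMonad.rawApplicative ¬¬-Monad)

lookup-injective : ∀ {A : Set} {xs : List A} → Unique xs → ∀ i j → lookup xs i ≡ lookup xs j → i ≡ j
lookup-injective (x∉ ∷ u) zero zero e = refl
lookup-injective {xs = _ ∷ xs} (x∉ ∷ u) zero (suc j) e = ⊥-elim (All.lookup x∉ (∈-lookup {xs = xs} j) e)
lookup-injective {xs = _ ∷ xs} (x∉ ∷ u) (suc i) zero e = ⊥-elim (All.lookup x∉ (∈-lookup {xs = xs} i) (≡.sym e))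
lookup-injective (x∉ ∷ u) (suc i) (suc j) e = cong suc (lookup-injective u i j e)

inhabited : ∀ n → .{{NonZero n}} → Fin n
inhabited (ℕ.suc n) = zero

-- The empty clique extends to a singleton, so it is not maximal.
maximal-clique-nonempty : ∀ {n} .{{_ : NonZero n}} (G : Graph n) {C} → IsMaximalClique G C → Nonempty C
maximal-clique-nonempty {n} G {C} (_ , maximal) with nonempty? C
... | yes x∈ = x∈
... | no empty = v , maximal ⁅ v ⁆ singleton-clique (λ x∈ → ⊥-elim (empty (_ , x∈))) (x∈⁅x⁆ v)
  where
  v : Fin n
  v = inhabited n
  singleton-clique : IsClique G ⁅ v ⁆
  singleton-clique x y x∈ y∈ x≢y =
    ⊥-elim (x≢y (≡.trans (x∈⁅y⁆⇒x≡y v x∈) (≡.sym (x∈⁅y⁆⇒x≡y v y∈))))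

maximal-cliques-equal : ∀ {n} (G : Graph n) {C C′} → IsMaximalClique G C → IsMaximalClique G C′ →
  IsClique G (C ∪ C′) → C ≡ C′
maximal-cliques-equal G {C} {C′} (_ , max) (_ , max′) clique = ⊆-antisym
  (λ x∈ → max′ (C ∪ C′) clique (q⊆p∪q C C′) (p⊆p∪q C′ x∈))
  (λ x∈ → max (C ∪ C′) clique (p⊆p∪q C′) (q⊆p∪q C C′ x∈))

maximum : ∀ {n} (S : Subset n) → Nonempty S → (g : Fin n → Point) → ∀ u v →
  ¬ ¬ (∃[ x ] (x ∈ S × (∀ y → y ∈ S → g y ⊑[ u , v ] g x)))
maximum S (a , a∈) g u v k = select {G = _∈ S} (λ x y → g y ⊑[ u , v ] g x)
  (λ x y → ⊑-total u v (g y) (g x))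
  (λ {x} {y} {z} _ _ _ h h′ → ⊑-trans {u} {v} {g z} {g y} {g x} h′ h)
  (allFin _) a a∈ λ (x , x∈ , _ , h) → k (x , x∈ , λ y → h y (∈-allFin y))

self-intersecting : ∀ P → Intersecting P P
self-intersecting P = g zero , generator∈hull g zero , generator∈hull g zero
  where
  g = Polygon.generators P

module Counting {k n : ℕ} (G : Graph n) (L : Lines k) (P : Fin n → Polygon)
  (P∈ : ∀ v → P v ∈𝒫 L) (intersection : IsIntersectionGraph G P) (l₀ : Fin k) where

  infix 4 _⊑⟨_⟩_
  _⊑⟨_⟩_ : Point → Fin k → Point → Set
  p ⊑⟨ l ⟩ q = p ⊑[ direction L l , rot (direction L l) ] q

  generator : ∀ v → Fin (ℕ.suc (Polygon.size-1 (P v))) → Point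
  generator v = Polygon.generators (P v)

  IsLowest : Fin k → ∀ v → Fin (ℕ.suc (Polygon.size-1 (P v))) → Set
  IsLowest l v i = ∀ j → generator v i ⊑⟨ l ⟩ generator v j

  -- Both hypotheses are available up to double negation, which suffices since the cliques are
  -- counted by refuting that there are too many.
  module Cliques (low : ∀ l v → ∃[ i ] IsLowest l v i)
    (adjacent? : ∀ u v → Dec (Adjacent G u v)) where

    lowest : Fin k → Fin n → Point
    lowest l v = generator v (proj₁ (low l v))

    clique-intersecting : ∀ {C u v} → IsClique G C → u ∈ C → v ∈ C → Intersecting (P u) (P v)
    clique-intersecting {C} {u} {v} clique u∈ v∈ with u Fin.≟ v
    ... | yes refl = self-intersecting (P u)
    ... | no u≢v = Equivalence.to (intersection u v u≢v) (clique u v u∈ v∈ u≢v)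

    -- A common point c comes after the first generator of v and before the last one of u. This
    -- passes from c to generators, for which separation is stated.
    lowest-reached : ∀ l u v → Intersecting (P u) (P v) →
      ¬ ¬ (∃[ i ] (lowest l v ⊑⟨ l ⟩ generator u i))
    lowest-reached l u v (c , c∈u , c∈v) k =
      minimum (allFin _) ∈-allFin zero (generator u) (opposite d) (opposite (rot d)) λ (i , h) →
      k (i , ⊑-trans {d} {rot d} {lowest l v} {c} {generator u i}
        (below-hull {g = generator v} {d} {rot d} {lowest l v} {c} (proj₂ (low l v)) c∈v)
        (above-hull {g = generator u} {d} {rot d} {generator u i} {c}
          (λ j → opposite-⊑ {d} {rot d} {generator u j} {generator u i} (h j)) c∈u))
      where
      d : Point
      d = direction L l

    IsTop : Subset n → Fin k → Fin n → Set
    IsTop C l v = v ∈ C × (∀ u → u ∈ C → lowest l u ⊑⟨ l ⟩ lowest l v)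

    union-adjacent : ∀ {C C′} → IsClique G C → IsClique G C′ →
      (∀ l → ∃[ v ] (IsTop C l v × IsTop C′ l v)) →
      ∀ {u w} → u ∈ C → w ∈ C′ → u ≢ w → Adjacent G u w
    union-adjacent {C} {C′} clique clique′ tops {u} {w} u∈ w∈ u≢w with adjacent? u w
    ... | yes a = a
    ... | no ¬a = ⊥-elim (disjoint⇒separated L l₀ (P u) (P w) (P∈ u) (P∈ w)
      (λ meet → ¬a (Equivalence.from (intersection u w u≢w) meet)) λ
        -- Here w comes before u. But the first point of u is no later than that of v, and v meets
        -- w, both being members of C′.
        { (l , inj₁ above) → let (v , (v∈ , top) , (v∈′ , _)) = tops l in
            lowest-reached l w v (clique-intersecting clique′ w∈ v∈′) λ (j , h) →
            above (proj₁ (low l u)) j (chain l u v (generator w j) (top u u∈) h)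
        ; (l , inj₂ above) → let (v , (v∈ , _) , (v∈′ , top)) = tops l in
            lowest-reached l u v (clique-intersecting clique u∈ v∈) λ (i , h) →
            above i (proj₁ (low l w)) (chain l w v (generator u i) (top w w∈) h) })
      where
      chain : ∀ l u v x → lowest l u ⊑⟨ l ⟩ lowest l v → lowest l v ⊑⟨ l ⟩ x → lowest l u ⊑⟨ l ⟩ x
      chain l u v x = ⊑-trans {direction L l} {rot (direction L l)} {lowest l u} {lowest l v} {x}

    same-tops⇒equal : ∀ {C C′} → IsMaximalClique G C → IsMaximalClique G C′ →
      (∀ l → ∃[ v ] (IsTop C l v × IsTop C′ l v)) → C ≡ C′
    same-tops⇒equal {C} {C′} max max′ tops = maximal-cliques-equal G max max′ union
      where
      union : IsClique G (C ∪ C′)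
      union u v u∈ v∈ u≢v with x∈p∪q⁻ C C′ u∈ | x∈p∪q⁻ C C′ v∈
      ... | inj₁ u∈C  | inj₁ v∈C  = proj₁ max u v u∈C v∈C u≢v
      ... | inj₂ u∈C′ | inj₂ v∈C′ = proj₁ max′ u v u∈C′ v∈C′ u≢v
      ... | inj₁ u∈C  | inj₂ v∈C′ = union-adjacent (proj₁ max) (proj₁ max′) tops u∈C v∈C′ u≢v
      ... | inj₂ u∈C′ | inj₁ v∈C  = symmetric G
        (union-adjacent (proj₁ max) (proj₁ max′) tops v∈C u∈C′ (λ e → u≢v (≡.sym e)))

    -- The choices of top members, one for each direction, are coded by numbers below n ^ k. By the
    -- pigeonhole principle two positions of the list share a code, hence also the clique, against
    -- uniqueness.
    few-cliques : (𝒞 : List (Subset n)) → Unique 𝒞 → All (IsMaximalClique G) 𝒞 →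
      (∀ c l → ∃[ v ] IsTop (lookup 𝒞 c) l v) → ¬ (n ^ k ℕ.< length 𝒞)
    few-cliques 𝒞 unique maximal top many with Fin.pigeonhole many (λ c → funToFin (λ l → proj₁ (top c l)))
    ... | i , j , i<j , e = ℕ.<⇒≢ i<j (cong Fin.toℕ (lookup-injective unique i j (same-tops⇒equal
        (max i) (max j) λ l → proj₁ (top i l) , proj₂ (top i l)
          , subst (IsTop (lookup 𝒞 j) l) (≡.sym (same l)) (proj₂ (top j l)))))
      where
      max : ∀ c → IsMaximalClique G (lookup 𝒞 c)
      max c = All.lookup maximal (∈-lookup {xs = 𝒞} c)
      same : ∀ l → proj₁ (top i l) ≡ proj₁ (top j l)
      same l = ≡.trans (≡.sym (Fin.finToFun-funToFin (λ l → proj₁ (top i l)) l))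
        (≡.trans (cong (λ t → finToFun t l) e) (Fin.finToFun-funToFin (λ l → proj₁ (top j l)) l))

theorem3 : ∀ (k n : ℕ) → .{{_ : NonZero k}} → .{{_ : NonZero n}} →
    (G : Graph n) → (k -DIR-CONV) G →
    (𝒞 : List (Subset n)) → Unique 𝒞 → All (IsMaximalClique G) 𝒞 →
    length 𝒞 ≤ℕ n ^ k
-- Assuming too many cliques leaves absurdity as the goal. Lowest generators, decisions of adjacency
-- and top members can then be chosen classically.
theorem3 k n G (L , P , P∈ , intersection) 𝒞 unique maximal = ℕ.≮⇒≥ λ many →
  ¬¬-Π (λ l → ¬¬-Π λ v →
    minimum (allFin _) ∈-allFin zero (generator v) (direction L l) (rot (direction L l))) λ low →
  ¬¬-Π (λ u → ¬¬-Π λ v → ¬¬-excluded-middle {A = Adjacent G u v}) λ adjacent? →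
  let open Cliques low adjacent? in
  ¬¬-Π (λ c → ¬¬-Π λ l → maximum (lookup 𝒞 c)
    (maximal-clique-nonempty G (All.lookup maximal (∈-lookup {xs = 𝒞} c)))
    (lowest l) (direction L l) (rot (direction L l))) λ top →
  few-cliques 𝒞 unique maximal top many
  where
  open Counting G L P P∈ intersection (inhabited k)
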